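{- Testing uniformity requires at least $\Omega(\log\log n)$ non-adaptive conditional samples for some fixed $\epsilon$. That is, there exist constants $\epsilon>0$ and $c>0$ such that for all sufficiently large $n$, every non-adaptive distribution tester for the property of being the uniform distribution over $[n]$, with distance parameter $\epsilon$ and error bound $\delta=\frac13$, must use at least $c\log\log n$ conditional samples.
   Context: $[n]=\{1,\ldots,n\}$; the variation distance is $d(\mu,\mu')=\frac12\sum_{i=1}^n|\mu(i)-\mu'(i)|$. A conditional sampling oracle for a distribution $\mu$ over $[n]$ takes a nonempty set $A\subseteq[n]$ and returns $j\in A$ with probability $\mu(j)/\mu(A)$ if $\mu(A)>0$, and a uniformly random member of $A$ if $\mu(A)=0$, independently of all previous samples. A non-adaptive distribution tester for uniformity (with parameters $\epsilon,\delta,n$) is a randomized algorithm that first generates, before receiving any sample, sets $A_1,\ldots,A_t\subseteq[n]$, then receives $j_1,\ldots,j_t$, where $j_i$ is the oracle's answer on $A_i$, and then accepts or rejects based on $j_1,\ldots,j_t$ and its internal coin tosses. It must accept with probability at least $1-\delta$ if $\mu$ is the uniform distribution over $[n]$, and reject with probability at least $1-\delta$ if $d(\mu,\mu')\ge\epsilon$ for $\mu'$ the uniform distribution over $[n]$. The number of samples it uses is $t$. -}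

module Defs where

open import Algebra.Bundles using (CommutativeRing)
import Algebra.Definitions.RawMonoid as RawMonoidDefs
open import Data.Bool using (Bool; true; false; if_then_else_) renaming (_≟_ to _≟ᵇ_)
open import Data.Fin using (Fin)
open import Data.Fin.Subset using (Subset; Nonempty; _∈_; _∉_; ∣_∣)
open import Data.Nat as ℕ using (ℕ; zero; suc)
open import Data.Nat.Logarithm using (⌈log₂_⌉)
open import Data.Product using (∃-syntax; _×_)
open import Data.Vec using (Vec; []; _∷_; lookup)
open import Data.Vec.Functional using (Vector)
open import Level using (_⊔_) renaming (suc to lsuc)
open import Relation.Binary.Core using (Rel)
open import Relation.Binary.Definitions using (Cotransitive)
open import Relation.Binary.Lattice.Definitions using (Supremum)
open import Relation.Binary.Structures using (IsStrictPartialOrder)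
open import Relation.Nullary using (¬_; does)

-- A model of the real numbers: a Cauchy-complete Archimedean ordered field.
-- The order is axiomatised as in constructive mathematics (cf. the HoTT book,
-- Definition 11.2.7): nothing here assumes that _<_ or _≈_ is decidable, so
-- that Bishop's reals are a model; with excluded middle the axioms are the
-- usual ones, and ℝ is the only model up to isomorphism.

record RealField c ℓ₁ ℓ₂ : Set (lsuc (c ⊔ ℓ₁ ⊔ ℓ₂)) where
  infix  4 _<_ _≤_
  infixl 6 _∨_
  field
    commutativeRing : CommutativeRing c ℓ₁

  open CommutativeRing commutativeRing public

  field
    _<_                  : Rel Carrier ℓ₂
    isStrictPartialOrder : IsStrictPartialOrder _≈_ _<_
    <-cotrans            : Cotransitive _<_
    <-tight              : ∀ {x y} → ¬ (x < y) → ¬ (y < x) → x ≈ y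

    0<1     : 0# < 1#
    +-monoˡ : ∀ {x y} z → x < y → x + z < y + z
    *-pos   : ∀ {x y} → 0# < x → 0# < y → 0# < x * y

    inv       : ∀ {x} → 0# < x → Carrier
    inv-right : ∀ {x} (x>0 : 0# < x) → x * inv x>0 ≈ 1#

  _≤_ : Rel Carrier ℓ₂
  x ≤ y = ¬ (y < x)

  fromℕ : ℕ → Carrier
  fromℕ n = RawMonoidDefs._×_ +-rawMonoid n 1#

  field
    _∨_      : Carrier → Carrier → Carrier
    supremum : Supremum _≤_ _∨_

    archimedean : ∀ x → ∃[ n ] x < fromℕ n

    -- Since i and j are interchangeable, the hypothesis bounds ∣ s i - s j ∣.
    complete :
      (s : ℕ → Carrier) →
      (∀ k → ∃[ N ] ∀ i j → N ℕ.≤ i → N ℕ.≤ j → fromℕ k * (s i - s j) < 1#) →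
      ∃[ l ] ∀ k → ∃[ N ] ∀ i → N ℕ.≤ i →
        (fromℕ k * (s i - l) < 1#) × (fromℕ k * (l - s i) < 1#)

  open IsStrictPartialOrder isStrictPartialOrder public
    using (<-respˡ-≈; <-respʳ-≈)
    renaming (irrefl to <-irrefl; trans to <-trans; asym to <-asym)

  fromℕ-pos : ∀ n → 0# < fromℕ (suc n)
  fromℕ-pos zero    = <-respʳ-≈ (sym (+-identityʳ 1#)) 0<1
  fromℕ-pos (suc n) = <-trans 0<1
    (<-respˡ-≈ (+-identityˡ 1#)
      (<-respʳ-≈ (+-comm (fromℕ (suc n)) 1#) (+-monoˡ 1# (fromℕ-pos n))))

  -- 1 / n, with the value 0 at n = 0.
  recip : ℕ → Carrier
  recip zero    = 0#
  recip (suc n) = inv (fromℕ-pos n)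

  abs : Carrier → Carrier
  abs x = x ∨ (- x)

  sum : ∀ {n} → Vector Carrier n → Carrier
  sum = RawMonoidDefs.sum +-rawMonoid

  product : ∀ {n} → Vector Carrier n → Carrier
  product = RawMonoidDefs.sum *-rawMonoid

  -- The sum over all of [n]ᵗ.
  sumVec : ∀ {n} t → (Vec (Fin n) t → Carrier) → Carrier
  sumVec zero    f = f []
  sumVec (suc t) f = sum λ j → sumVec t λ js → f (j ∷ js)

-- For n ≥ 2 this equals ⌈log₂ log₂ n⌉, which lies between log₂ log₂ n and
-- 2 log₂ log₂ n once n ≥ 4.
loglog : ℕ → ℕ
loglog n = ⌈log₂ ⌈log₂ n ⌉ ⌉

module Testing {c ℓ₁ ℓ₂} (ℝ : RealField c ℓ₁ ℓ₂) where
  open RealField ℝ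

  IsDistribution : ∀ {n} → Vector Carrier n → Set (ℓ₁ ⊔ ℓ₂)
  IsDistribution μ = (∀ i → 0# ≤ μ i) × (sum μ ≈ 1#)

  uniform : ∀ n → Vector Carrier n
  uniform n _ = recip n

  measure : ∀ {n} → Vector Carrier n → Subset n → Carrier
  measure μ A = sum λ i → if lookup A i then μ i else 0#

  variationDistance : ∀ {n} → Vector Carrier n → Vector Carrier n → Carrier
  variationDistance μ μ′ = recip 2 * sum λ i → abs (μ i - μ′ i)

  -- q A j is the probability that the oracle for μ answers j on the set A.
  -- A relation rather than a function of μ, because whether μ(A) > 0 or
  -- μ(A) = 0 need not be decidable.
  record IsConditionalOracle {n} (μ : Vector Carrier n)
                             (q : Subset n → Fin n → Carrier) : Set (ℓ₁ ⊔ ℓ₂) where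
    field
      positive : ∀ A → Nonempty A → (μA>0 : 0# < measure μ A) →
                 ∀ j → j ∈ A → q A j ≈ μ j * inv μA>0
      null     : ∀ A → Nonempty A → measure μ A ≈ 0# →
                 ∀ j → j ∈ A → q A j ≈ recip ∣ A ∣
      outside  : ∀ A → Nonempty A → ∀ j → j ∉ A → q A j ≈ 0#

  -- A non-adaptive algorithm taking t samples. All coin tosses, including those
  -- used after the samples arrive, are drawn in advance as a seed from a finite
  -- probability space with arbitrary real weights. This loses no generality:
  -- there are finitely many pairs of a query sequence in (2^[n])ᵗ and a decision
  -- function [n]ᵗ → Bool, and an algorithm amounts to a distribution on them.
  record Tester (n t : ℕ) : Set (c ⊔ ℓ₁ ⊔ ℓ₂) where
    field
      seeds      : ℕ
      weight     : Vector Carrier seeds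
      weight-isD : IsDistribution weight
      queries    : Fin seeds → Vec (Subset n) t
      nonempty   : ∀ r i → Nonempty (lookup (queries r) i)
      accepts?   : Fin seeds → Vec (Fin n) t → Bool

  -- The probability that the verdict is b (true: accept, false: reject), the
  -- i-th sample being drawn from q (Aᵢ) independently of everything else.
  verdictProb : ∀ {n t} → Tester n t → (Subset n → Fin n → Carrier) → Bool → Carrier
  verdictProb {n} {t} T q b =
    sum λ r → weight r *
      sumVec t λ js →
        product (λ i → q (lookup (queries r) i) (lookup js i)) *
        (if does (accepts? r js ≟ᵇ b) then 1# else 0#)
    where open Tester T

  record IsUniformityTester {n t} (ε δ : Carrier) (T : Tester n t)
         : Set (c ⊔ ℓ₁ ⊔ ℓ₂) where
    field
      accepts : ∀ μ q → IsDistribution μ → IsConditionalOracle μ q →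
                (∀ i → μ i ≈ uniform n i) →
                1# - δ ≤ verdictProb T q true
      rejects : ∀ μ q → IsDistribution μ → IsConditionalOracle μ q →
                ε ≤ variationDistance μ (uniform n) →
                1# - δ ≤ verdictProb T q false

{-# OPTIONS --safe #-}
module Submission where

open import Defs
open import Data.Bool using (Bool; true; false; if_then_else_; not; _∧_) renaming (_≟_ to _≟ᵇ_)
open import Data.Fin as Fin using (Fin; zero; suc; toℕ)
open import Data.Fin.Properties using (_≟_; any?; toℕ<n)
open import Data.Fin.Subset using (Subset; Nonempty; _∈_; _∉_; ∣_∣)
open import Data.Fin.Subset.Properties using (∣p∣≤n)
open import Data.List using (List; []; _∷_; _++_; length)
open import Data.List.Relation.Binary.Permutation.Propositional as ↭ using (_↭_)
open import Data.Nat as ℕ using (ℕ; zero; suc; z≤n; s≤s)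
open import Data.Nat.Logarithm using (⌈log₂_⌉; ⌈log₂⌉-mono-≤; ⌈log₂2^n⌉≡n)
import Data.Nat.Properties as ℕₚ
open import Data.Nat.Solver using (module +-*-Solver)
open import Data.Product using (∃-syntax; _×_; _,_; proj₁; proj₂)
open import Data.Sum using (inj₁; inj₂)
open import Data.Vec using (Vec; []; _∷_; lookup; there)
open import Data.Vec.Functional using (Vector)
open import Data.Vec.Properties using ([]=⇒lookup; lookup⇒[]=)
open import Function using (_∘_)
open import Relation.Binary.Bundles using (Poset)
open import Relation.Binary.PropositionalEquality as ≡ using (_≡_; _≢_)
open import Relation.Nullary using (¬_; Dec; does; yes; no; contradiction; ¬?; _×-dec_)
open import Relation.Nullary.Decidable using (dec-true; dec-false)

-- The distribution μ hidden from the tester is the empirical distribution of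
-- t + M independent uniform points of [n], where t is the number of samples and
-- the scale M is a random power of a number polynomial in t; it has support at
-- most n / 2, hence is far from uniform. At a given scale a query set A is
-- expected to contain about M ∣A∣ / n points. If this is tiny then A misses all
-- the points, and the oracle answers uniformly. If it is huge then the answer is
-- a random point in A, again uniform, and the points revealed by different
-- queries are all fresh. Each query set is of neither kind at one scale at most,
-- and log n is so much larger than any polynomial in t (this is where t much
-- below log log n enters) that most scales have no such set. So on average the
-- tester accepts the μ's almost as often as the uniform distribution.
--
-- The answers are compared by a lower bound on the probability of each sequence
-- of answers. It involves the expectation of a product of terms 1 / X, with X the
-- number of points in a query set; as this product is convex in the X's, the
-- means of the X's are all that matters and no concentration is needed.


-- The size of n against the scales

n≤2^n : ∀ n → n ℕ.≤ 2 ℕ.^ n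
n≤2^n zero    = z≤n
n≤2^n (suc n) = ℕₚ.+-mono-≤ (ℕₚ.m^n>0 2 n) (ℕₚ.≤-trans (n≤2^n n) (ℕₚ.m≤m+n (2 ℕ.^ n) 0))

loglog-≤ : ∀ {n k} → n ℕ.≤ 2 ℕ.^ (2 ℕ.^ k) → loglog n ℕ.≤ k
loglog-≤ {n} {k} n≤ = ≡.subst (loglog n ℕ.≤_) (≡.trans (≡.cong ⌈log₂_⌉ (⌈log₂2^n⌉≡n (2 ℕ.^ k))) (⌈log₂2^n⌉≡n k))
  (⌈log₂⌉-mono-≤ (⌈log₂⌉-mono-≤ n≤))

-- With T one more than the number of samples, the error at a good scale is at most
-- 2T³ / threshold T = 1 / 12, and fewer than T of the scaleCount T scales are bad.
threshold : ℕ → ℕ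
threshold T = 24 ℕ.* (T ℕ.* (T ℕ.* T))

scaleCount : ℕ → ℕ
scaleCount T = 12 ℕ.* T

module _ where
  open ℕₚ.≤-Reasoning
  open +-*-Solver using () renaming (solve to solveℕ; _:*_ to _⊗_; _:+_ to _⊕_; con to conℕ; _:=_ to _⊜_)

  threshold≤ : ∀ T .{{_ : ℕ.NonZero T}} → threshold T ℕ.≤ 2 ℕ.^ (8 ℕ.* T)
  threshold≤ T = begin
    24 ℕ.* (T ℕ.* (T ℕ.* T))
      ≤⟨ ℕₚ.*-mono-≤ {24} {2 ℕ.^ (5 ℕ.* T)} (ℕₚ.≤-trans (ℕₚ.m≤m+n 24 8) (ℕₚ.^-monoʳ-≤ 2 (ℕₚ.m≤m*n 5 T)))
           (ℕₚ.*-mono-≤ (n≤2^n T) (ℕₚ.*-mono-≤ (n≤2^n T) (n≤2^n T))) ⟩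
    2 ℕ.^ (5 ℕ.* T) ℕ.* (2 ℕ.^ T ℕ.* (2 ℕ.^ T ℕ.* 2 ℕ.^ T))
      ≡⟨ ≡.cong (2 ℕ.^ (5 ℕ.* T) ℕ.*_) (≡.cong (2 ℕ.^ T ℕ.*_) (ℕₚ.^-distribˡ-+-* 2 T T)) ⟨
    2 ℕ.^ (5 ℕ.* T) ℕ.* (2 ℕ.^ T ℕ.* 2 ℕ.^ (T ℕ.+ T))
      ≡⟨ ≡.cong (2 ℕ.^ (5 ℕ.* T) ℕ.*_) (ℕₚ.^-distribˡ-+-* 2 T (T ℕ.+ T)) ⟨
    2 ℕ.^ (5 ℕ.* T) ℕ.* 2 ℕ.^ (T ℕ.+ (T ℕ.+ T))
      ≡⟨ ℕₚ.^-distribˡ-+-* 2 (5 ℕ.* T) (T ℕ.+ (T ℕ.+ T)) ⟨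
    2 ℕ.^ (5 ℕ.* T ℕ.+ (T ℕ.+ (T ℕ.+ T)))
      ≡⟨ ≡.cong (2 ℕ.^_) (solveℕ 1 (λ T → conℕ 5 ⊗ T ⊕ (T ⊕ (T ⊕ T)) ⊜ conℕ 8 ⊗ T) ≡.refl T) ⟩
    2 ℕ.^ (8 ℕ.* T) ∎

  exponent≤ : ∀ T .{{_ : ℕ.NonZero T}} → 2 ℕ.+ 192 ℕ.* (T ℕ.* T) ℕ.≤ 2 ℕ.^ (10 ℕ.* T)
  exponent≤ T = begin
    2 ℕ.+ 192 ℕ.* (T ℕ.* T)
      ≤⟨ ℕₚ.+-monoˡ-≤ (192 ℕ.* (T ℕ.* T)) (ℕₚ.≤-trans (ℕₚ.m≤m+n 2 62) (ℕₚ.m≤m*n 64 (T ℕ.* T) {{ℕₚ.m*n≢0 T T}})) ⟩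
    64 ℕ.* (T ℕ.* T) ℕ.+ 192 ℕ.* (T ℕ.* T)
      ≡⟨ ℕₚ.*-distribʳ-+ (T ℕ.* T) 64 192 ⟨
    256 ℕ.* (T ℕ.* T)
      ≤⟨ ℕₚ.*-mono-≤ {256} {2 ℕ.^ (8 ℕ.* T)} (ℕₚ.^-monoʳ-≤ 2 (ℕₚ.m≤m*n 8 T)) (ℕₚ.*-mono-≤ (n≤2^n T) (n≤2^n T)) ⟩
    2 ℕ.^ (8 ℕ.* T) ℕ.* (2 ℕ.^ T ℕ.* 2 ℕ.^ T)
      ≡⟨ ≡.cong (2 ℕ.^ (8 ℕ.* T) ℕ.*_) (ℕₚ.^-distribˡ-+-* 2 T T) ⟨
    2 ℕ.^ (8 ℕ.* T) ℕ.* 2 ℕ.^ (T ℕ.+ T)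
      ≡⟨ ℕₚ.^-distribˡ-+-* 2 (8 ℕ.* T) (T ℕ.+ T) ⟨
    2 ℕ.^ (8 ℕ.* T ℕ.+ (T ℕ.+ T))
      ≡⟨ ≡.cong (2 ℕ.^_) (solveℕ 1 (λ T → conℕ 8 ⊗ T ⊕ (T ⊕ T) ⊜ conℕ 10 ⊗ T) ≡.refl T) ⟩
    2 ℕ.^ (10 ℕ.* T) ∎

  scale≤ : ∀ T .{{_ : ℕ.NonZero T}} k → k ℕ.≤ scaleCount T →
           (threshold T ℕ.* threshold T) ℕ.^ k ℕ.≤ 2 ℕ.^ (192 ℕ.* (T ℕ.* T))
  scale≤ T k k≤ = begin
    (threshold T ℕ.* threshold T) ℕ.^ k
      ≤⟨ ℕₚ.^-monoˡ-≤ k (ℕₚ.*-mono-≤ (threshold≤ T) (threshold≤ T)) ⟩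
    (2 ℕ.^ (8 ℕ.* T) ℕ.* 2 ℕ.^ (8 ℕ.* T)) ℕ.^ k
      ≡⟨ ≡.cong (ℕ._^ k) (ℕₚ.^-distribˡ-+-* 2 (8 ℕ.* T) (8 ℕ.* T)) ⟨
    (2 ℕ.^ (8 ℕ.* T ℕ.+ 8 ℕ.* T)) ℕ.^ k
      ≡⟨ ℕₚ.^-*-assoc 2 (8 ℕ.* T ℕ.+ 8 ℕ.* T) k ⟩
    2 ℕ.^ ((8 ℕ.* T ℕ.+ 8 ℕ.* T) ℕ.* k)
      ≤⟨ ℕₚ.^-monoʳ-≤ 2 (ℕₚ.*-monoʳ-≤ (8 ℕ.* T ℕ.+ 8 ℕ.* T) k≤) ⟩
    2 ℕ.^ ((8 ℕ.* T ℕ.+ 8 ℕ.* T) ℕ.* (12 ℕ.* T))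
      ≡⟨ ≡.cong (2 ℕ.^_) (solveℕ 1 (λ T → (conℕ 8 ⊗ T ⊕ conℕ 8 ⊗ T) ⊗ (conℕ 12 ⊗ T) ⊜ conℕ 192 ⊗ (T ⊗ T)) ≡.refl T) ⟩
    2 ℕ.^ (192 ℕ.* (T ℕ.* T)) ∎

  scales-fit : ∀ t {n} → 2 ℕ.^ (2 ℕ.^ (10 ℕ.* suc t)) ℕ.≤ n → ∀ (k : Fin (scaleCount (suc t))) →
               (t ℕ.+ (threshold (suc t) ℕ.* threshold (suc t)) ℕ.^ toℕ k) ℕ.* 2 ℕ.≤ n
  scales-fit t {n} large k = begin
    (t ℕ.+ (threshold T ℕ.* threshold T) ℕ.^ toℕ k) ℕ.* 2
      ≤⟨ ℕₚ.*-monoˡ-≤ 2 (ℕₚ.+-mono-≤ t≤ (scale≤ T (toℕ k) (ℕₚ.<⇒≤ (toℕ<n k)))) ⟩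
    (E ℕ.+ E) ℕ.* 2                  ≡⟨ solveℕ 1 (λ E → (E ⊕ E) ⊗ conℕ 2 ⊜ conℕ 4 ⊗ E) ≡.refl E ⟩
    4 ℕ.* E                          ≡⟨ ℕₚ.^-distribˡ-+-* 2 2 (192 ℕ.* (T ℕ.* T)) ⟨
    2 ℕ.^ (2 ℕ.+ 192 ℕ.* (T ℕ.* T))  ≤⟨ ℕₚ.^-monoʳ-≤ 2 (exponent≤ T) ⟩
    2 ℕ.^ (2 ℕ.^ (10 ℕ.* T))         ≤⟨ large ⟩
    n                                ∎
    where
    T = suc t
    E = 2 ℕ.^ (192 ℕ.* (T ℕ.* T))
    t≤ : t ℕ.≤ E
    t≤ = ℕₚ.≤-trans (n≤2^n t) (ℕₚ.^-monoʳ-≤ 2 (ℕₚ.≤-trans (ℕₚ.n≤1+n t)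
      (ℕₚ.≤-trans (ℕₚ.m≤m*n T T) (ℕₚ.m≤n*m (T ℕ.* T) 192))))

  -- One sample more is absorbed by doubling the constant, except when t = 0.
  loglog-large : ∀ t {n} → 2 ℕ.^ (2 ℕ.^ 10) ℕ.≤ n → t ℕ.* 20 ℕ.< loglog n → 2 ℕ.^ (2 ℕ.^ (10 ℕ.* suc t)) ℕ.≤ n
  loglog-large zero    N≤n _ = N≤n
  loglog-large (suc t) {n} _ t<  = ℕₚ.≮⇒≥ λ n< → ℕₚ.<⇒≱ t< (begin
    loglog n                       ≤⟨ loglog-≤ (ℕₚ.<⇒≤ n<) ⟩
    10 ℕ.* suc (suc t)             ≤⟨ ℕₚ.m≤m+n _ (10 ℕ.* t) ⟩
    10 ℕ.* suc (suc t) ℕ.+ 10 ℕ.* t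
      ≡⟨ solveℕ 1 (λ t → conℕ 10 ⊗ (conℕ 2 ⊕ t) ⊕ conℕ 10 ⊗ t ⊜ (conℕ 1 ⊕ t) ⊗ conℕ 20) ≡.refl t ⟩
    suc t ℕ.* 20                   ∎)

module _ {a ℓ₁ ℓ₂} (ℝ : RealField a ℓ₁ ℓ₂) where
  open RealField ℝ hiding (zero)
  open Testing ℝ
  import Algebra.Properties.CommutativeMonoid.Sum *-commutativeMonoid as Prod
  import Algebra.Properties.Ring ring as Ring
  open import Algebra.Properties.Semiring.Exp semiring using (_^_)
  import Algebra.Properties.Semiring.Mult semiring as Mult
  import Algebra.Properties.Semiring.Sum semiring as Sum
  open import Algebra.Solver.Ring.NaturalCoefficients.Default commutativeSemiring
    using (solve; _:+_; _:*_; con; _:=_)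

  -- Ordered field arithmetic

  ≤-reflexive : ∀ {x y} → x ≈ y → x ≤ y
  ≤-reflexive x≈y = <-irrefl (sym x≈y)

  ≤-refl : ∀ {x} → x ≤ x
  ≤-refl = ≤-reflexive refl

  ≤-trans : ∀ {x y z} → x ≤ y → y ≤ z → x ≤ z
  ≤-trans {y = y} x≤y y≤z z<x with <-cotrans z<x y
  ... | inj₁ z<y = y≤z z<y
  ... | inj₂ y<x = x≤y y<x

  ≤-antisym : ∀ {x y} → x ≤ y → y ≤ x → x ≈ y
  ≤-antisym x≤y y≤x = <-tight y≤x x≤y

  <⇒≤ : ∀ {x y} → x < y → x ≤ y
  <⇒≤ x<y y<x = <-asym x<y y<x

  ≤-poset : Poset a ℓ₁ ℓ₂
  ≤-poset = record
    { isPartialOrder = record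
      { isPreorder = record
        { isEquivalence = isEquivalence ; reflexive = ≤-reflexive ; trans = ≤-trans }
      ; antisym = ≤-antisym } }

  open import Relation.Binary.Reasoning.PartialOrder ≤-poset

  -- x ≤ y ⊎ y ≤ x is not provable here, but ≤ is a negation.
  ≤-by-cases : ∀ x y {u v} → (x ≤ y → u ≤ v) → (y ≤ x → u ≤ v) → u ≤ v
  ≤-by-cases x y f g v<u = f (λ y<x → g (<⇒≤ y<x) v<u) v<u

  +-cancel-neg : ∀ x z → x + z + - z ≈ x
  +-cancel-neg x z = trans (+-assoc x z (- z)) (trans (+-congˡ (-‿inverseʳ z)) (+-identityʳ x))

  +-monoˡ-≤ : ∀ {x y} z → x ≤ y → x + z ≤ y + z
  +-monoˡ-≤ {x} {y} z x≤y y+z<x+z =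
    x≤y (<-respˡ-≈ (+-cancel-neg y z) (<-respʳ-≈ (+-cancel-neg x z) (+-monoˡ (- z) y+z<x+z)))

  +-mono-≤ : ∀ {x y u v} → x ≤ y → u ≤ v → x + u ≤ y + v
  +-mono-≤ {x} {y} {u} {v} x≤y u≤v = begin
    x + u  ≤⟨ +-monoˡ-≤ u x≤y ⟩
    y + u  ≈⟨ +-comm y u ⟩
    u + y  ≤⟨ +-monoˡ-≤ y u≤v ⟩
    v + y  ≈⟨ +-comm v y ⟩
    y + v  ∎

  +-monoʳ-≤ : ∀ {x y} z → x ≤ y → z + x ≤ z + y
  +-monoʳ-≤ z = +-mono-≤ ≤-refl

  +-cancelʳ-≤ : ∀ z {x y} → x + z ≤ y + z → x ≤ y
  +-cancelʳ-≤ z x+z≤y+z y<x = x+z≤y+z (+-monoˡ z y<x)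

  x≤x+y : ∀ {x y} → 0# ≤ y → x ≤ x + y
  x≤x+y {x} {y} 0≤y = ≤-trans (≤-reflexive (sym (+-identityʳ x))) (+-monoʳ-≤ x 0≤y)

  +-nonneg : ∀ {x y} → 0# ≤ x → 0# ≤ y → 0# ≤ x + y
  +-nonneg 0≤x 0≤y = ≤-trans 0≤x (x≤x+y 0≤y)

  difference : ∀ x y → x + (y - x) ≈ y
  difference x y = trans (+-comm x (y - x)) (trans (+-assoc y (- x) x)
    (trans (+-congˡ (-‿inverseˡ x)) (+-identityʳ y)))

  x≤y⇒0≤y-x : ∀ {x y} → x ≤ y → 0# ≤ y - x
  x≤y⇒0≤y-x {x} x≤y = ≤-trans (≤-reflexive (sym (-‿inverseʳ x))) (+-monoˡ-≤ (- x) x≤y)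

  *-monoˡ-< : ∀ {x y z} → 0# < z → x < y → x * z < y * z
  *-monoˡ-< {x} {y} {z} 0<z x<y =
    <-respˡ-≈ (+-identityˡ (x * z)) (<-respʳ-≈ lemma (+-monoˡ (x * z)
      (*-pos (<-respˡ-≈ (-‿inverseʳ x) (+-monoˡ (- x) x<y)) 0<z)))
    where
    lemma : (y - x) * z + x * z ≈ y * z
    lemma = trans (sym (distribʳ z (y - x) x))
      (*-congʳ (trans (+-comm (y - x) x) (difference x y)))

  *-cancelʳ-≤ : ∀ {z x y} → 0# < z → x * z ≤ y * z → x ≤ y
  *-cancelʳ-≤ 0<z xz≤yz y<x = xz≤yz (*-monoˡ-< 0<z y<x)

  *-cancelʳ-≈ : ∀ {z x y} → 0# < z → x * z ≈ y * z → x ≈ y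
  *-cancelʳ-≈ 0<z xz≈yz = ≤-antisym
    (*-cancelʳ-≤ 0<z (≤-reflexive xz≈yz)) (*-cancelʳ-≤ 0<z (≤-reflexive (sym xz≈yz)))

  *-monoˡ-≤ : ∀ {x y z} → 0# ≤ z → x ≤ y → x * z ≤ y * z
  *-monoˡ-≤ {x} {y} {z} 0≤z x≤y yz<xz = ¬0<z (λ z≈0 → <-irrefl
      (trans (*-congˡ z≈0) (trans (zeroʳ y) (sym (trans (*-congˡ z≈0) (zeroʳ x))))) yz<xz)
    where
    ¬0<z : ¬ ¬ z ≈ 0#
    ¬0<z z≉0 = z≉0 (<-tight 0≤z λ 0<z →
      <-irrefl (*-congʳ (<-tight x≤y λ x<y → <-asym (*-monoˡ-< 0<z x<y) yz<xz)) yz<xz)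

  *-mono-≤ : ∀ {x y u v} → 0# ≤ u → 0# ≤ y → x ≤ y → u ≤ v → x * u ≤ y * v
  *-mono-≤ {x} {y} {u} {v} 0≤u 0≤y x≤y u≤v = begin
    x * u  ≤⟨ *-monoˡ-≤ 0≤u x≤y ⟩
    y * u  ≈⟨ *-comm y u ⟩
    u * y  ≤⟨ *-monoˡ-≤ 0≤y u≤v ⟩
    v * y  ≈⟨ *-comm v y ⟩
    y * v  ∎

  *-monoʳ-≤ : ∀ {x y z} → 0# ≤ z → x ≤ y → z * x ≤ z * y
  *-monoʳ-≤ {x} {y} {z} 0≤z x≤y =
    ≤-trans (≤-reflexive (*-comm z x)) (≤-trans (*-monoˡ-≤ 0≤z x≤y) (≤-reflexive (*-comm y z)))

  *-nonneg : ∀ {x y} → 0# ≤ x → 0# ≤ y → 0# ≤ x * y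
  *-nonneg {x} {y} 0≤x 0≤y = ≤-trans (≤-reflexive (sym (zeroˡ y))) (*-monoˡ-≤ 0≤y 0≤x)

  0≤1 : 0# ≤ 1#
  0≤1 = <⇒≤ 0<1

  fromℕ-+ : ∀ m n → fromℕ (m ℕ.+ n) ≈ fromℕ m + fromℕ n
  fromℕ-+ = Mult.×-homo-+ 1#

  fromℕ-* : ∀ m n → fromℕ (m ℕ.* n) ≈ fromℕ m * fromℕ n
  fromℕ-* = Mult.×1-homo-*

  fromℕ-1 : fromℕ 1 ≈ 1#
  fromℕ-1 = +-identityʳ 1#

  fromℕ-nonneg : ∀ n → 0# ≤ fromℕ n
  fromℕ-nonneg zero    = ≤-refl
  fromℕ-nonneg (suc n) = <⇒≤ (fromℕ-pos n)

  fromℕ-mono-≤ : ∀ {m n} → m ℕ.≤ n → fromℕ m ≤ fromℕ n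
  fromℕ-mono-≤ {n = n} z≤n = fromℕ-nonneg n
  fromℕ-mono-≤ (s≤s m≤n)   = +-monoʳ-≤ 1# (fromℕ-mono-≤ m≤n)

  fromℕ-positive : ∀ n .{{_ : ℕ.NonZero n}} → 0# < fromℕ n
  fromℕ-positive (suc n) = fromℕ-pos n

  recip-inverseʳ : ∀ n .{{_ : ℕ.NonZero n}} → fromℕ n * recip n ≈ 1#
  recip-inverseʳ (suc n) = inv-right (fromℕ-pos n)

  recip-inverseˡ : ∀ n .{{_ : ℕ.NonZero n}} → recip n * fromℕ n ≈ 1#
  recip-inverseˡ n = trans (*-comm _ _) (recip-inverseʳ n)

  recip-nonneg : ∀ n → 0# ≤ recip n
  recip-nonneg zero    = ≤-refl
  recip-nonneg (suc n) = *-cancelʳ-≤ (fromℕ-pos n)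
    (≤-trans (≤-reflexive (zeroˡ _)) (≤-trans 0≤1 (≤-reflexive (sym (recip-inverseˡ (suc n))))))

  fromℕ-*-cancel-pos : ∀ n {x} → 0# < fromℕ n * x → 0# < x
  fromℕ-*-cancel-pos zero    0<0x = contradiction 0<0x (<-irrefl (sym (zeroˡ _)))
  fromℕ-*-cancel-pos (suc n) {x} 0<nx
    with <-cotrans (<-respʳ-≈ (trans (distribʳ x 1# (fromℕ n)) (+-congʳ (*-identityˡ x))) 0<nx) x
  ... | inj₁ 0<x    = 0<x
  ... | inj₂ x<x+nx = fromℕ-*-cancel-pos n (<-respˡ-≈ (-‿inverseʳ x)
    (<-respʳ-≈ (trans (+-congʳ (+-comm x _)) (+-cancel-neg _ x)) (+-monoˡ (- x) x<x+nx)))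

  recip-positive : ∀ n .{{_ : ℕ.NonZero n}} → 0# < recip n
  recip-positive n = fromℕ-*-cancel-pos n (<-respʳ-≈ (sym (recip-inverseʳ n)) 0<1)

  recip-unique : ∀ n .{{_ : ℕ.NonZero n}} {x} → x * fromℕ n ≈ 1# → x ≈ recip n
  recip-unique n eq = *-cancelʳ-≈ (fromℕ-positive n) (trans eq (sym (recip-inverseˡ n)))

  recip-* : ∀ m n .{{_ : ℕ.NonZero m}} .{{_ : ℕ.NonZero n}} → recip (m ℕ.* n) ≈ recip m * recip n
  recip-* m@(suc _) n@(suc _) = sym (recip-unique (m ℕ.* n) (begin-equality
    recip m * recip n * fromℕ (m ℕ.* n)        ≈⟨ *-congˡ (fromℕ-* m n) ⟩
    recip m * recip n * (fromℕ m * fromℕ n)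
      ≈⟨ solve 4 (λ p q r s → p :* q :* (r :* s) := (p :* r) :* (q :* s)) refl _ _ _ _ ⟩
    recip m * fromℕ m * (recip n * fromℕ n)    ≈⟨ *-cong (recip-inverseˡ m) (recip-inverseˡ n) ⟩
    1# * 1#                                    ≈⟨ *-identityˡ 1# ⟩
    1#                                         ∎))

  cross-multiply : ∀ m n p q .{{_ : ℕ.NonZero n}} .{{_ : ℕ.NonZero p}} →
                   m ℕ.* n ℕ.≤ q ℕ.* p → fromℕ m * recip p ≤ fromℕ q * recip n
  cross-multiply m n@(suc _) p@(suc _) q mn≤qp =
    *-cancelʳ-≤ (fromℕ-positive (n ℕ.* p)) (begin
      fromℕ m * recip p * fromℕ (n ℕ.* p)            ≈⟨ *-congˡ (fromℕ-* n p) ⟩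
      fromℕ m * recip p * (fromℕ n * fromℕ p)
        ≈⟨ solve 4 (λ m p′ n p → m :* p′ :* (n :* p) := m :* n :* (p′ :* p)) refl _ _ _ _ ⟩
      fromℕ m * fromℕ n * (recip p * fromℕ p)        ≈⟨ *-cong (sym (fromℕ-* m n)) (recip-inverseˡ p) ⟩
      fromℕ (m ℕ.* n) * 1#                           ≤⟨ *-monoˡ-≤ 0≤1 (fromℕ-mono-≤ mn≤qp) ⟩
      fromℕ (q ℕ.* p) * 1#                           ≈⟨ *-cong (fromℕ-* q p) (sym (recip-inverseˡ n)) ⟩
      fromℕ q * fromℕ p * (recip n * fromℕ n)
        ≈⟨ solve 4 (λ q p n′ n → q :* p :* (n′ :* n) := q :* n′ :* (n :* p)) refl _ _ _ _ ⟩
      fromℕ q * recip n * (fromℕ n * fromℕ p)        ≈⟨ *-congˡ (fromℕ-* n p) ⟨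
      fromℕ q * recip n * fromℕ (n ℕ.* p)            ∎)

  recip-antitone : ∀ {m n} .{{_ : ℕ.NonZero m}} .{{_ : ℕ.NonZero n}} → m ℕ.≤ n → recip n ≤ recip m
  recip-antitone {m} {n} m≤n = begin
    recip n            ≈⟨ trans (*-congʳ fromℕ-1) (*-identityˡ _) ⟨
    fromℕ 1 * recip n  ≤⟨ cross-multiply 1 m n 1 (ℕₚ.*-monoʳ-≤ 1 m≤n) ⟩
    fromℕ 1 * recip m  ≈⟨ trans (*-congʳ fromℕ-1) (*-identityˡ _) ⟩
    recip m            ∎

  sum-mono : ∀ {n} {f g : Fin n → Carrier} → (∀ i → f i ≤ g i) → sum f ≤ sum g
  sum-mono {zero}  f≤g = ≤-refl
  sum-mono {suc n} f≤g = +-mono-≤ (f≤g zero) (sum-mono (f≤g ∘ suc))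

  sum-cong : ∀ {n} {f g : Fin n → Carrier} → (∀ i → f i ≈ g i) → sum f ≈ sum g
  sum-cong {zero}  f≈g = refl
  sum-cong {suc n} f≈g = +-cong (f≈g zero) (sum-cong (f≈g ∘ suc))

  sum-nonneg : ∀ {n} {f : Fin n → Carrier} → (∀ i → 0# ≤ f i) → 0# ≤ sum f
  sum-nonneg {zero}  0≤f = ≤-refl
  sum-nonneg {suc n} 0≤f = +-nonneg (0≤f zero) (sum-nonneg (0≤f ∘ suc))

  sum-const : ∀ n x → sum {n} (λ _ → x) ≈ fromℕ n * x
  sum-const zero    x = sym (zeroˡ x)
  sum-const (suc n) x =
    trans (+-cong (sym (*-identityˡ x)) (sum-const n x)) (sym (distribʳ x 1# (fromℕ n)))

  sum-zero : ∀ {n} {f : Fin n → Carrier} → (∀ i → f i ≈ 0#) → sum f ≈ 0#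
  sum-zero {n} f≈0 = trans (sum-cong f≈0) (trans (sum-const n 0#) (zeroʳ _))

  term≤sum : ∀ {n} {f : Fin n → Carrier} → (∀ i → 0# ≤ f i) → ∀ i → f i ≤ sum f
  term≤sum 0≤f zero    = x≤x+y (sum-nonneg (0≤f ∘ suc))
  term≤sum {f = f} 0≤f (suc i) = ≤-trans (term≤sum (0≤f ∘ suc) i)
    (≤-trans (x≤x+y (0≤f zero)) (≤-reflexive (+-comm _ _)))

  product-nonneg : ∀ {n} {f : Fin n → Carrier} → (∀ i → 0# ≤ f i) → 0# ≤ product f
  product-nonneg {zero}  0≤f = 0≤1
  product-nonneg {suc n} 0≤f = *-nonneg (0≤f zero) (product-nonneg (0≤f ∘ suc))

  product-mono : ∀ {n} {f g : Fin n → Carrier} → (∀ i → 0# ≤ f i) → (∀ i → f i ≤ g i) →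
                 product f ≤ product g
  product-mono {zero}  0≤f f≤g = ≤-refl
  product-mono {suc n} 0≤f f≤g = *-mono-≤ (product-nonneg (0≤f ∘ suc))
    (≤-trans (0≤f zero) (f≤g zero)) (f≤g zero) (product-mono (0≤f ∘ suc) (f≤g ∘ suc))

  product-cong : ∀ {n} {f g : Fin n → Carrier} → (∀ i → f i ≈ g i) → product f ≈ product g
  product-cong {zero}  f≈g = refl
  product-cong {suc n} f≈g = *-cong (f≈g zero) (product-cong (f≈g ∘ suc))

  product-* : ∀ {n} (f g : Fin n → Carrier) → product (λ i → f i * g i) ≈ product f * product g
  product-* = Prod.∑-distrib-+

  2xy≤x²+y² : ∀ x y → x * y + x * y ≤ x * x + y * y
  2xy≤x²+y² x y = ≤-by-cases x y (ordered x y) λ y≤x → begin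
    x * y + x * y  ≈⟨ +-cong (*-comm x y) (*-comm x y) ⟩
    y * x + y * x  ≤⟨ ordered y x y≤x ⟩
    y * y + x * x  ≈⟨ +-comm _ _ ⟩
    x * x + y * y  ∎
    where
    ordered : ∀ x y → x ≤ y → x * y + x * y ≤ x * x + y * y
    ordered x y x≤y = begin
      x * y + x * y                          ≈⟨ +-cong (*-congˡ y≈) (*-congˡ y≈) ⟩
      x * (x + d) + x * (x + d)              ≤⟨ x≤x+y (*-nonneg 0≤d 0≤d) ⟩
      x * (x + d) + x * (x + d) + d * d
        ≈⟨ solve 2 (λ x d → x :* (x :+ d) :+ x :* (x :+ d) :+ d :* d
                         := x :* x :+ (x :+ d) :* (x :+ d)) refl x d ⟩
      x * x + (x + d) * (x + d)              ≈⟨ +-congˡ (*-cong y≈ y≈) ⟨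
      x * x + y * y                          ∎
      where
      d = y - x
      0≤d = x≤y⇒0≤y-x x≤y
      y≈ : y ≈ x + d
      y≈ = sym (difference x y)

  -- A tangent form of the inequality of arithmetic and geometric means

  ^-nonneg : ∀ {x} k → 0# ≤ x → 0# ≤ x ^ k
  ^-nonneg zero    0≤x = 0≤1
  ^-nonneg (suc k) 0≤x = *-nonneg 0≤x (^-nonneg k 0≤x)

  1^k≈1 : ∀ k → 1# ^ k ≈ 1#
  1^k≈1 zero    = refl
  1^k≈1 (suc k) = trans (*-identityˡ _) (1^k≈1 k)

  weighted-am-gm₂ : ∀ k {c z} → 0# ≤ c → 0# ≤ z →
                    fromℕ (suc k) * (c * z ^ k) ≤ c ^ suc k + fromℕ k * z ^ suc k
  weighted-am-gm₂ zero {c} {z} 0≤c 0≤z = ≤-reflexive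
    (solve 2 (λ c z → (con 1 :+ con 0) :* (c :* con 1) := c :* con 1 :+ con 0 :* (z :* con 1)) refl c z)
  weighted-am-gm₂ (suc k) {c} {z} 0≤c 0≤z = +-cancelʳ-≤ (fromℕ k * (c * (z * p))) (begin
    (1# + (1# + K)) * (c * (z * p)) + K * (c * (z * p))
      ≈⟨ solve 4 (λ K c z p → (con 1 :+ (con 1 :+ K)) :* (c :* (z :* p)) :+ K :* (c :* (z :* p))
           := (con 1 :+ K) :* p :* (c :* z :+ c :* z)) refl K c z p ⟩
    (1# + K) * p * (c * z + c * z)
      ≤⟨ *-monoʳ-≤ (*-nonneg (fromℕ-nonneg (suc k)) (^-nonneg k 0≤z)) (2xy≤x²+y² c z) ⟩
    (1# + K) * p * (c * c + z * z)
      ≈⟨ solve 4 (λ K c z p → (con 1 :+ K) :* p :* (c :* c :+ z :* z)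
           := c :* ((con 1 :+ K) :* (c :* p)) :+ (con 1 :+ K) :* (z :* (z :* p))) refl K c z p ⟩
    c * ((1# + K) * (c * p)) + (1# + K) * (z * (z * p))
      ≤⟨ +-monoˡ-≤ _ (*-monoʳ-≤ 0≤c (weighted-am-gm₂ k 0≤c 0≤z)) ⟩
    c * (c * q + K * (z * p)) + (1# + K) * (z * (z * p))
      ≈⟨ solve 5 (λ K c z p q → c :* (c :* q :+ K :* (z :* p)) :+ (con 1 :+ K) :* (z :* (z :* p))
           := c :* (c :* q) :+ (con 1 :+ K) :* (z :* (z :* p)) :+ K :* (c :* (z :* p))) refl K c z p q ⟩
    c * (c * q) + (1# + K) * (z * (z * p)) + K * (c * (z * p)) ∎)
    where
    K = fromℕ k
    p = z ^ k
    q = c ^ k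

  am-gm-tangent-scaled : ∀ s {c} {y : Fin s → Carrier} → 0# ≤ c → (∀ i → 0# ≤ y i) →
    fromℕ (suc s) * c * product y ≤ c ^ suc s + product y * sum y
  am-gm-tangent-scaled zero {c} _ _ = ≤-reflexive
    (solve 1 (λ c → (con 1 :+ con 0) :* c :* con 1 := c :* con 1 :+ con 1 :* con 0) refl c)
  am-gm-tangent-scaled (suc s) {c} {y} 0≤c 0≤y = ≤-by-cases ((1# + fromℕ (suc s)) * c) x large small
    where
    x = y zero
    P = product (y ∘ suc)
    S = sum (y ∘ suc)
    0≤x = 0≤y zero
    0≤P = product-nonneg (0≤y ∘ suc)
    0≤S = sum-nonneg (0≤y ∘ suc)

    large : (1# + fromℕ (suc s)) * c ≤ x →
            (1# + fromℕ (suc s)) * c * (x * P) ≤ c ^ suc (suc s) + x * P * (x + S)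
    large le = begin
      (1# + fromℕ (suc s)) * c * (x * P)  ≤⟨ *-monoˡ-≤ (*-nonneg 0≤x 0≤P) (≤-trans le (x≤x+y 0≤S)) ⟩
      (x + S) * (x * P)                   ≈⟨ *-comm _ _ ⟩
      x * P * (x + S)                     ≤⟨ x≤x+y (^-nonneg (suc (suc s)) 0≤c) ⟩
      x * P * (x + S) + c ^ suc (suc s)   ≈⟨ +-comm _ _ ⟩
      c ^ suc (suc s) + x * P * (x + S)   ∎

    -- The rescaled level c′ makes (s + 2) c = x + (s + 1) c′.
    small : x ≤ (1# + fromℕ (suc s)) * c →
            (1# + fromℕ (suc s)) * c * (x * P) ≤ c ^ suc (suc s) + x * P * (x + S)
    small le = begin
      (1# + F) * c * (x * P)                    ≈⟨ *-congʳ split ⟩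
      (x + F * c′) * (x * P)
        ≈⟨ solve 4 (λ x P F c → (x :+ F :* c) :* (x :* P)
             := x :* (F :* c :* P) :+ x :* P :* x) refl x P F c′ ⟩
      x * (F * c′ * P) + x * P * x
        ≤⟨ +-monoˡ-≤ _ (*-monoʳ-≤ 0≤x (am-gm-tangent-scaled s 0≤c′ (0≤y ∘ suc))) ⟩
      x * (c′ ^ suc s + P * S) + x * P * x
        ≈⟨ solve 4 (λ x q P S → x :* (q :+ P :* S) :+ x :* P :* x
             := x :* q :+ x :* P :* (x :+ S)) refl x (c′ ^ suc s) P S ⟩
      x * c′ ^ suc s + x * P * (x + S)          ≤⟨ +-monoˡ-≤ _ bound ⟩
      c ^ suc (suc s) + x * P * (x + S)         ∎
      where
      F = fromℕ (suc s)
      d = (1# + F) * c - x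
      c′ = recip (suc s) * d
      0≤c′ : 0# ≤ c′
      0≤c′ = *-nonneg (recip-nonneg (suc s)) (x≤y⇒0≤y-x le)
      split : (1# + F) * c ≈ x + F * c′
      split = trans (sym (difference x _)) (+-congˡ (sym
        (trans (sym (*-assoc F (recip (suc s)) d)) (trans (*-congʳ (recip-inverseʳ (suc s))) (*-identityˡ d)))))
      bound : x * c′ ^ suc s ≤ c ^ suc (suc s)
      bound = +-cancelʳ-≤ (F * c′ ^ suc (suc s)) (begin
        x * c′ ^ suc s + F * (c′ * c′ ^ suc s)
          ≈⟨ solve 4 (λ x q F c → x :* q :+ F :* (c :* q) := (x :+ F :* c) :* q) refl x (c′ ^ suc s) F c′ ⟩
        (x + F * c′) * c′ ^ suc s         ≈⟨ *-congʳ split ⟨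
        (1# + F) * c * c′ ^ suc s         ≈⟨ *-assoc _ _ _ ⟩
        (1# + F) * (c * c′ ^ suc s)       ≤⟨ weighted-am-gm₂ (suc s) 0≤c 0≤c′ ⟩
        c ^ suc (suc s) + F * c′ ^ suc (suc s)  ∎)

  am-gm-tangent : ∀ s {y : Fin s → Carrier} → (∀ i → 0# ≤ y i) →
                  fromℕ (suc s) * product y ≤ 1# + product y * sum y
  am-gm-tangent s {y} 0≤y = begin
    fromℕ (suc s) * product y           ≈⟨ *-congʳ (*-identityʳ _) ⟨
    fromℕ (suc s) * 1# * product y      ≤⟨ am-gm-tangent-scaled s 0≤1 0≤y ⟩
    1# ^ suc s + product y * sum y      ≈⟨ +-congʳ (1^k≈1 (suc s)) ⟩
    1# + product y * sum y              ∎

  -- Uniform samples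

  indicator : Bool → Carrier
  indicator b = if b then 1# else 0#

  if-nonneg : ∀ b {x y} → 0# ≤ x → 0# ≤ y → 0# ≤ (if b then x else y)
  if-nonneg true  0≤x _ = 0≤x
  if-nonneg false _ 0≤y = 0≤y

  if-mono : ∀ b {x x′ y y′} → x ≤ x′ → y ≤ y′ → (if b then x else y) ≤ (if b then x′ else y′)
  if-mono true  x≤x′ _ = x≤x′
  if-mono false _ y≤y′ = y≤y′

  if-cong : ∀ b {x x′ y y′} → x ≈ x′ → y ≈ y′ → (if b then x else y) ≈ (if b then x′ else y′)
  if-cong true  x≈x′ _ = x≈x′
  if-cong false _ y≈y′ = y≈y′

  indicator-nonneg : ∀ b → 0# ≤ indicator b
  indicator-nonneg true  = 0≤1
  indicator-nonneg false = ≤-refl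

  indicator≤1 : ∀ b → indicator b ≤ 1#
  indicator≤1 true  = ≤-refl
  indicator≤1 false = 0≤1

  sum-delta : ∀ {n} (j : Fin n) (h : Fin n → Carrier) →
              sum (λ x → indicator (does (j ≟ x)) * h x) ≈ h j
  sum-delta zero    h = trans (+-cong (*-identityˡ _) (sum-zero {f = λ x → 0# * h (suc x)} λ x → zeroˡ _)) (+-identityʳ _)
  sum-delta (suc j) h = trans (+-cong (zeroˡ _) (sum-delta j (h ∘ suc))) (+-identityˡ _)

  count : ∀ {n} → (Fin n → Bool) → List (Fin n) → ℕ
  count p []       = 0
  count p (x ∷ xs) = if p x then suc (count p xs) else count p xs

  count-∷ : ∀ {n} p (x : Fin n) xs → fromℕ (count p (x ∷ xs)) ≈ indicator (p x) + fromℕ (count p xs)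
  count-∷ p x xs with p x
  ... | true  = refl
  ... | false = sym (+-identityˡ _)

  count-++ : ∀ {n} p (xs ys : List (Fin n)) → count p (xs ++ ys) ≡ count p xs ℕ.+ count p ys
  count-++ p []       ys = ≡.refl
  count-++ p (x ∷ xs) ys with p x
  ... | true  = ≡.cong suc (count-++ p xs ys)
  ... | false = count-++ p xs ys

  count≤length : ∀ {n} p (xs : List (Fin n)) → count p xs ℕ.≤ length xs
  count≤length p []       = z≤n
  count≤length p (x ∷ xs) with p x
  ... | true  = s≤s (count≤length p xs)
  ... | false = ℕₚ.m≤n⇒m≤1+n (count≤length p xs)

  count-↭ : ∀ {n} p {xs ys : List (Fin n)} → xs ↭ ys → count p xs ≡ count p ys
  count-↭ p ↭.refl = ≡.refl
  count-↭ p (↭.prep x r) with p x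
  ... | true  = ≡.cong suc (count-↭ p r)
  ... | false = count-↭ p r
  count-↭ p (↭.swap x y r) with p x | p y
  ... | true  | true  = ≡.cong (2 ℕ.+_) (count-↭ p r)
  ... | true  | false = ≡.cong suc (count-↭ p r)
  ... | false | true  = ≡.cong suc (count-↭ p r)
  ... | false | false = count-↭ p r
  count-↭ p (↭.trans r s) = ≡.trans (count-↭ p r) (count-↭ p s)

  Symmetric : ∀ {n} → (List (Fin n) → Carrier) → Set ℓ₁
  Symmetric g = ∀ {xs ys} → xs ↭ ys → g xs ≈ g ys

  module Expectation (n : ℕ) .{{_ : ℕ.NonZero n}} where

    𝔼 : ℕ → (List (Fin n) → Carrier) → Carrier
    𝔼 zero    g = g []
    𝔼 (suc m) g = recip n * sum λ x → 𝔼 m λ f → g (x ∷ f)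

    𝔼-mono : ∀ m {g h} → (∀ f → length f ≡ m → g f ≤ h f) → 𝔼 m g ≤ 𝔼 m h
    𝔼-mono zero    g≤h = g≤h [] ≡.refl
    𝔼-mono (suc m) g≤h = *-monoʳ-≤ (recip-nonneg n) (sum-mono λ x →
      𝔼-mono m λ f eq → g≤h (x ∷ f) (≡.cong suc eq))

    𝔼-cong : ∀ m {g h} → (∀ f → g f ≈ h f) → 𝔼 m g ≈ 𝔼 m h
    𝔼-cong zero    g≈h = g≈h []
    𝔼-cong (suc m) g≈h = *-congˡ (sum-cong λ x → 𝔼-cong m λ f → g≈h (x ∷ f))

    𝔼-const : ∀ m x → 𝔼 m (λ _ → x) ≈ x
    𝔼-const zero    x = refl
    𝔼-const (suc m) x = begin-equality
      recip n * sum {n} (λ _ → 𝔼 m (λ _ → x))  ≈⟨ *-congˡ (sum-const n _) ⟩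
      recip n * (fromℕ n * 𝔼 m (λ _ → x))      ≈⟨ *-assoc _ _ _ ⟨
      recip n * fromℕ n * 𝔼 m (λ _ → x)        ≈⟨ *-cong (recip-inverseˡ n) (𝔼-const m x) ⟩
      1# * x                                   ≈⟨ *-identityˡ x ⟩
      x                                        ∎

    𝔼-nonneg : ∀ m {g} → (∀ f → 0# ≤ g f) → 0# ≤ 𝔼 m g
    𝔼-nonneg m 0≤g = ≤-trans (≤-reflexive (sym (𝔼-const m 0#))) (𝔼-mono m λ f _ → 0≤g f)

    𝔼-+ : ∀ m g h → 𝔼 m (λ f → g f + h f) ≈ 𝔼 m g + 𝔼 m h
    𝔼-+ zero    g h = refl
    𝔼-+ (suc m) g h = trans (*-congˡ (trans (sum-cong λ x → 𝔼-+ m (g ∘ (x ∷_)) (h ∘ (x ∷_)))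
      (Sum.∑-distrib-+ (λ x → 𝔼 m (g ∘ (x ∷_))) (λ x → 𝔼 m (h ∘ (x ∷_)))))) (distribˡ _ _ _)

    𝔼-*ˡ : ∀ m x g → 𝔼 m (λ f → x * g f) ≈ x * 𝔼 m g
    𝔼-*ˡ zero    x g = refl
    𝔼-*ˡ (suc m) x g = trans (*-congˡ (trans (sum-cong λ y → 𝔼-*ˡ m x (g ∘ (y ∷_)))
      (sym (Sum.*-distribˡ-sum x (λ y → 𝔼 m (g ∘ (y ∷_)))))))
      (solve 3 (λ r x s → r :* (x :* s) := x :* (r :* s)) refl _ _ _)

    𝔼-sum : ∀ m {k} (g : Fin k → List (Fin n) → Carrier) →
            𝔼 m (λ f → sum λ i → g i f) ≈ sum λ i → 𝔼 m (g i)
    𝔼-sum m {zero}  g = 𝔼-const m 0#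
    𝔼-sum m {suc k} g = trans (𝔼-+ m (g zero) (λ f → sum λ i → g (suc i) f)) (+-congˡ (𝔼-sum m (g ∘ suc)))

    𝔼-count : ∀ m p → 𝔼 m (λ f → fromℕ (count p f)) ≈ fromℕ m * (recip n * sum (indicator ∘ p))
    𝔼-count zero    p = sym (zeroˡ _)
    𝔼-count (suc m) p = begin-equality
      recip n * sum (λ x → 𝔼 m λ f → fromℕ (count p (x ∷ f)))
        ≈⟨ *-congˡ (sum-cong λ x → trans (𝔼-cong m (count-∷ p x)) (trans (𝔼-+ m _ _)
             (+-cong (𝔼-const m _) (𝔼-count m p)))) ⟩
      recip n * sum (λ x → indicator (p x) + μ)
        ≈⟨ *-congˡ (trans (Sum.∑-distrib-+ {n} (indicator ∘ p) (λ _ → μ)) (+-congˡ (sum-const n μ))) ⟩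
      recip n * (sum (indicator ∘ p) + fromℕ n * μ)
        ≈⟨ solve 4 (λ r s n μ → r :* (s :+ n :* μ) := r :* s :+ r :* n :* μ) refl _ _ _ _ ⟩
      recip n * sum (indicator ∘ p) + recip n * fromℕ n * μ
        ≈⟨ +-cong (sym (*-identityˡ _)) (trans (*-congʳ (recip-inverseˡ n)) (*-identityˡ μ)) ⟩
      1# * (recip n * sum (indicator ∘ p)) + fromℕ m * (recip n * sum (indicator ∘ p))
        ≈⟨ distribʳ _ _ _ ⟨
      fromℕ (suc m) * (recip n * sum (indicator ∘ p)) ∎
      where
      μ = fromℕ m * (recip n * sum (indicator ∘ p))

    multiplicity : Fin n → List (Fin n) → Carrier
    multiplicity j f = fromℕ (count (λ x → does (j ≟ x)) f)

    multiplicity-∷ : ∀ j x f → multiplicity j (x ∷ f) ≈ indicator (does (j ≟ x)) + multiplicity j f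
    multiplicity-∷ j = count-∷ (λ x → does (j ≟ x))

    -- Exchangeability: each of the suc m positions is equally likely to hold j.
    𝔼-multiplicity : ∀ m j {g} → Symmetric g →
      𝔼 (suc m) (λ f → multiplicity j f * g f) ≈ fromℕ (suc m) * recip n * 𝔼 m (λ f → g (j ∷ f))
    𝔼-multiplicity m j {g} g-sym = begin-equality
      recip n * sum (λ x → 𝔼 m λ f → multiplicity j (x ∷ f) * g (x ∷ f))
        ≈⟨ *-congˡ (sum-cong λ x → trans (𝔼-cong m λ f → trans (*-congʳ (multiplicity-∷ j x f)) (distribʳ _ _ _))
             (trans (𝔼-+ m _ _) (+-congʳ (𝔼-*ˡ m _ _)))) ⟩
      recip n * sum (λ x → indicator (does (j ≟ x)) * 𝔼 m (λ f → g (x ∷ f))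
                           + 𝔼 m (λ f → multiplicity j f * g (x ∷ f)))
        ≈⟨ *-congˡ (trans (Sum.∑-distrib-+ {n} _ _) (+-cong (sum-delta j λ x → 𝔼 m (λ f → g (x ∷ f))) (later m))) ⟩
      recip n * (𝔼 m (λ f → g (j ∷ f)) + fromℕ m * 𝔼 m (λ f → g (j ∷ f)))
        ≈⟨ solve 3 (λ r e k → r :* (e :+ k :* e) := (con 1 :+ k) :* r :* e) refl _ _ _ ⟩
      fromℕ (suc m) * recip n * 𝔼 m (λ f → g (j ∷ f)) ∎
      where
      later : ∀ m → sum (λ x → 𝔼 m λ f → multiplicity j f * g (x ∷ f)) ≈ fromℕ m * 𝔼 m (λ f → g (j ∷ f))
      later zero    = trans (sum-zero {n} λ x → zeroˡ _) (sym (zeroˡ _))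
      later (suc m) = begin-equality
        sum (λ x → 𝔼 (suc m) λ f → multiplicity j f * g (x ∷ f))
          ≈⟨ sum-cong (λ x → trans (𝔼-multiplicity m j (g-sym ∘ ↭.prep x))
               (*-congˡ (𝔼-cong m λ f → g-sym (↭.swap x j ↭.refl)))) ⟩
        sum (λ x → fromℕ (suc m) * recip n * 𝔼 m (λ f → g (j ∷ x ∷ f)))
          ≈⟨ Sum.*-distribˡ-sum _ (λ x → 𝔼 m (λ f → g (j ∷ x ∷ f))) ⟨
        fromℕ (suc m) * recip n * sum (λ x → 𝔼 m (λ f → g (j ∷ x ∷ f)))
          ≈⟨ *-assoc _ _ _ ⟩
        fromℕ (suc m) * 𝔼 (suc m) (λ f → g (j ∷ f)) ∎

    select : ∀ {t} → (Fin t → Bool) → (Fin t → Fin n) → List (Fin n)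
    select {zero}  b js = []
    select {suc t} b js = if b zero then js zero ∷ select (b ∘ suc) (js ∘ suc)
                                    else select (b ∘ suc) (js ∘ suc)

    unselected : ∀ {t} → (Fin t → Bool) → ℕ
    unselected {zero}  b = 0
    unselected {suc t} b = if b zero then unselected (b ∘ suc) else suc (unselected (b ∘ suc))

    multiplicities : ∀ {t} → (Fin t → Bool) → (Fin t → Fin n) → List (Fin n) → Carrier
    multiplicities b js f = product λ i → if b i then multiplicity (js i) f else 1#

    multiplicities-sym : ∀ {t} (b : Fin t → Bool) js → Symmetric (multiplicities b js)
    multiplicities-sym b js r = product-cong λ i →
      if-cong (b i) (reflexive (≡.cong fromℕ (count-↭ (λ x → does (js i ≟ x)) r))) refl

    multiplicities-∷ : ∀ {t} (b : Fin t → Bool) js j f → multiplicities b js f ≤ multiplicities b js (j ∷ f)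
    multiplicities-∷ b js j f = product-mono
      (λ i → if-nonneg (b i) (fromℕ-nonneg (count _ f)) 0≤1)
      (λ i → if-mono (b i)
        (≤-trans (x≤x+y (indicator-nonneg _)) (≤-reflexive (trans (+-comm _ _) (sym (multiplicity-∷ (js i) j f)))))
        ≤-refl)

    𝔼-multiplicities : ∀ {t} (b : Fin t → Bool) (js : Fin t → Fin n) m {G} →
      Symmetric G → (∀ f → 0# ≤ G f) →
      product (λ i → if b i then fromℕ m * recip n else 1#) * 𝔼 (unselected b ℕ.+ m) (λ f → G (select b js ++ f))
      ≤ 𝔼 (t ℕ.+ m) (λ f → multiplicities b js f * G f)
    𝔼-multiplicities {zero}  b js m {G} G-sym 0≤G =
      ≤-reflexive (trans (*-identityˡ _) (𝔼-cong m λ f → sym (*-identityˡ _)))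
    𝔼-multiplicities {suc t} b js m {G} G-sym 0≤G with b zero
    ... | true = begin
      fromℕ m * recip n * Π m * 𝔼 (u ℕ.+ m) (λ f → G (j ∷ s ++ f))
        ≈⟨ *-assoc _ _ _ ⟩
      fromℕ m * recip n * (Π m * 𝔼 (u ℕ.+ m) (λ f → G (j ∷ s ++ f)))
        ≤⟨ *-mono-≤ 0≤IH (*-nonneg (fromℕ-nonneg (suc (t ℕ.+ m))) (recip-nonneg n))
             (*-monoˡ-≤ (recip-nonneg n) (fromℕ-mono-≤ (ℕₚ.m≤n+m m (suc t))))
             (𝔼-multiplicities b′ js′ m (G-sym ∘ ↭.prep j) (λ f → 0≤G (j ∷ f))) ⟩
      fromℕ (suc (t ℕ.+ m)) * recip n * 𝔼 (t ℕ.+ m) (λ f → W f * G (j ∷ f))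
        ≤⟨ *-monoʳ-≤ (*-nonneg (fromℕ-nonneg (suc (t ℕ.+ m))) (recip-nonneg n))
             (𝔼-mono (t ℕ.+ m) λ f _ → *-monoˡ-≤ (0≤G (j ∷ f)) (multiplicities-∷ b′ js′ j f)) ⟩
      fromℕ (suc (t ℕ.+ m)) * recip n * 𝔼 (t ℕ.+ m) (λ f → W (j ∷ f) * G (j ∷ f))
        ≈⟨ 𝔼-multiplicity (t ℕ.+ m) j {λ f → W f * G f}
             (λ r → *-cong (multiplicities-sym b′ js′ r) (G-sym r)) ⟨
      𝔼 (suc (t ℕ.+ m)) (λ f → multiplicity j f * (W f * G f))
        ≈⟨ 𝔼-cong (suc (t ℕ.+ m)) (λ f → sym (*-assoc (multiplicity j f) (W f) (G f))) ⟩
      𝔼 (suc (t ℕ.+ m)) (λ f → multiplicity j f * W f * G f) ∎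
      where
      j = js zero
      b′ = b ∘ suc
      js′ = js ∘ suc
      u = unselected b′
      s = select b′ js′
      W = multiplicities b′ js′
      Π : ℕ → Carrier
      Π m = product (λ i → if b′ i then fromℕ m * recip n else 1#)
      0≤IH : 0# ≤ Π m * 𝔼 (u ℕ.+ m) (λ f → G (j ∷ s ++ f))
      0≤IH = *-nonneg (product-nonneg λ i → if-nonneg (b′ i) (*-nonneg (fromℕ-nonneg m) (recip-nonneg n)) 0≤1)
        (𝔼-nonneg (u ℕ.+ m) λ f → 0≤G (j ∷ s ++ f))
    ... | false = begin
      1# * Π m * 𝔼 (suc (u ℕ.+ m)) g
        ≈⟨ *-cong (*-identityˡ _) (reflexive (≡.cong (λ k → 𝔼 k g) (≡.sym (ℕₚ.+-suc u m)))) ⟩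
      Π m * 𝔼 (u ℕ.+ suc m) g
        ≤⟨ *-monoˡ-≤ (𝔼-nonneg (u ℕ.+ suc m) λ f → 0≤G (select b′ js′ ++ f)) (product-mono
             (λ i → if-nonneg (b′ i) (*-nonneg (fromℕ-nonneg m) (recip-nonneg n)) 0≤1)
             (λ i → if-mono (b′ i) (*-monoˡ-≤ (recip-nonneg n) (fromℕ-mono-≤ (ℕₚ.n≤1+n m))) ≤-refl)) ⟩
      Π (suc m) * 𝔼 (u ℕ.+ suc m) g
        ≤⟨ 𝔼-multiplicities b′ js′ (suc m) G-sym 0≤G ⟩
      𝔼 (t ℕ.+ suc m) (λ f → W f * G f)
        ≈⟨ reflexive (≡.cong (λ k → 𝔼 k (λ f → W f * G f)) (ℕₚ.+-suc t m)) ⟩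
      𝔼 (suc (t ℕ.+ m)) (λ f → W f * G f)
        ≈⟨ 𝔼-cong (suc (t ℕ.+ m)) (λ f → *-congʳ {G f} (sym (*-identityˡ (W f)))) ⟩
      𝔼 (suc (t ℕ.+ m)) (λ f → 1# * W f * G f) ∎
      where
      b′ = b ∘ suc
      js′ = js ∘ suc
      u = unselected b′
      W = multiplicities b′ js′
      g : List (Fin n) → Carrier
      g f = G (select b′ js′ ++ f)
      Π : ℕ → Carrier
      Π m = product (λ i → if b′ i then fromℕ m * recip n else 1#)

  -- Empirical distributions and their oracles

  if-indicator : ∀ b {x} → (if b then x else 0#) ≈ indicator b * x
  if-indicator true  = sym (*-identityˡ _)
  if-indicator false = sym (zeroˡ _)

  ≟-sym : ∀ {n} (x y : Fin n) → does (x ≟ y) ≡ does (y ≟ x)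
  ≟-sym x y with x ≟ y
  ... | yes x≡y = ≡.sym (dec-true (y ≟ x) (≡.sym x≡y))
  ... | no x≢y  = ≡.sym (dec-false (y ≟ x) (x≢y ∘ ≡.sym))

  ∈⇒lookup : ∀ {n} {A : Subset n} {j} → j ∈ A → lookup A j ≡ true
  ∈⇒lookup = []=⇒lookup

  ∉⇒lookup : ∀ {n} {A : Subset n} {j} → j ∉ A → lookup A j ≡ false
  ∉⇒lookup {A = A} {j} j∉A with lookup A j in eq
  ... | true  = contradiction (lookup⇒[]= j A eq) j∉A
  ... | false = ≡.refl

  sum-indicator-lookup : ∀ {n} (A : Subset n) → sum (λ x → indicator (lookup A x)) ≈ fromℕ ∣ A ∣
  sum-indicator-lookup []          = refl
  sum-indicator-lookup (true  ∷ A) = +-congˡ (sum-indicator-lookup A)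
  sum-indicator-lookup (false ∷ A) = trans (+-identityˡ _) (sum-indicator-lookup A)

  ∣A∣-nonZero : ∀ {n} {A : Subset n} → Nonempty A → ℕ.NonZero ∣ A ∣
  ∣A∣-nonZero {A = true  ∷ A} _                        = _
  ∣A∣-nonZero {A = false ∷ A} (suc j , there j∈A) = ∣A∣-nonZero {A = A} (j , j∈A)

  inv-unique : ∀ {x y} (x>0 : 0# < x) → y * x ≈ 1# → inv x>0 ≈ y
  inv-unique x>0 yx≈1 = *-cancelʳ-≈ x>0 (trans (*-comm _ _) (trans (inv-right x>0) (sym yx≈1)))

  abs-nonneg : ∀ x → 0# ≤ abs x
  abs-nonneg x = ≤-by-cases 0# x (λ 0≤x → ≤-trans 0≤x (proj₁ (supremum x (- x))))
    λ x≤0 → ≤-trans (≤-trans (x≤y⇒0≤y-x x≤0) (≤-reflexive (+-identityˡ _)))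
                    (proj₁ (proj₂ (supremum x (- x))))

  module Oracles (n : ℕ) .{{_ : ℕ.NonZero n}} where
    open Expectation n

    empirical : List (Fin n) → Vector Carrier n
    empirical f x = multiplicity x f * recip (length f)

    conditional : List (Fin n) → Subset n → Fin n → ℕ → Carrier
    conditional f A j zero    = recip ∣ A ∣
    conditional f A j (suc k) = multiplicity j f * recip (suc k)

    empiricalOracle : List (Fin n) → Subset n → Fin n → Carrier
    empiricalOracle f A j = if lookup A j then conditional f A j (count (lookup A) f) else 0#

    uniformOracle : Subset n → Fin n → Carrier
    uniformOracle A j = if lookup A j then recip ∣ A ∣ else 0#

    sum-multiplicity : ∀ p f → sum (λ x → indicator (p x) * multiplicity x f) ≈ fromℕ (count p f)
    sum-multiplicity p []      = sum-zero {n} λ x → zeroʳ _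
    sum-multiplicity p (y ∷ f) = begin-equality
      sum (λ x → indicator (p x) * multiplicity x (y ∷ f))
        ≈⟨ sum-cong (λ x → trans (*-congˡ (multiplicity-∷ x y f)) (trans (distribˡ _ _ _)
             (+-congʳ (trans (*-comm _ _) (*-congʳ (reflexive (≡.cong indicator (≟-sym x y)))))))) ⟩
      sum (λ x → indicator (does (y ≟ x)) * indicator (p x) + indicator (p x) * multiplicity x f)
        ≈⟨ Sum.∑-distrib-+ {n} _ _ ⟩
      sum (λ x → indicator (does (y ≟ x)) * indicator (p x)) + sum (λ x → indicator (p x) * multiplicity x f)
        ≈⟨ +-cong (sum-delta y (indicator ∘ p)) (sum-multiplicity p f) ⟩
      indicator (p y) + fromℕ (count p f)
        ≈⟨ count-∷ p y f ⟨
      fromℕ (count p (y ∷ f)) ∎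

    count-all : ∀ (f : List (Fin n)) → count (λ _ → true) f ≡ length f
    count-all []      = ≡.refl
    count-all (x ∷ f) = ≡.cong suc (count-all f)

    sum-multiplicity-all : ∀ f → sum (λ x → multiplicity x f) ≈ fromℕ (length f)
    sum-multiplicity-all f = trans (sum-cong {n} λ x → sym (*-identityˡ _))
      (trans (sum-multiplicity (λ _ → true) f) (reflexive (≡.cong fromℕ (count-all f))))

    empirical-isDistribution : ∀ f .{{_ : ℕ.NonZero (length f)}} → IsDistribution (empirical f)
    empirical-isDistribution f = (λ x → *-nonneg (fromℕ-nonneg (count _ f)) (recip-nonneg (length f))) ,
      trans (sym (Sum.*-distribʳ-sum _ (λ x → multiplicity x f)))
        (trans (*-congʳ (sum-multiplicity-all f)) (recip-inverseʳ (length f)))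

    measure-empirical : ∀ f A → measure (empirical f) A ≈ fromℕ (count (lookup A) f) * recip (length f)
    measure-empirical f A = begin-equality
      sum (λ x → if lookup A x then empirical f x else 0#)
        ≈⟨ sum-cong (λ x → trans (if-indicator (lookup A x)) (sym (*-assoc _ _ _))) ⟩
      sum (λ x → indicator (lookup A x) * multiplicity x f * recip (length f))
        ≈⟨ Sum.*-distribʳ-sum _ (λ x → indicator (lookup A x) * multiplicity x f) ⟨
      sum (λ x → indicator (lookup A x) * multiplicity x f) * recip (length f)
        ≈⟨ *-congʳ (sum-multiplicity (lookup A) f) ⟩
      fromℕ (count (lookup A) f) * recip (length f) ∎

    empiricalOracle-isConditional : ∀ f .{{_ : ℕ.NonZero (length f)}} →
                                    IsConditionalOracle (empirical f) (empiricalOracle f)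
    empiricalOracle-isConditional f = record { positive = positive ; null = null ; outside = outside }
      where
      L = length f

      positive : ∀ A → Nonempty A → (μA>0 : 0# < measure (empirical f) A) →
                 ∀ j → j ∈ A → empiricalOracle f A j ≈ empirical f j * inv μA>0
      positive A _ μA>0 j j∈A rewrite ∈⇒lookup j∈A with count (lookup A) f | measure-empirical f A
      ... | zero  | μA≈ = contradiction μA>0 (<-irrefl (sym (trans μA≈ (zeroˡ _))))
      ... | suc k | μA≈ = sym (begin-equality
        multiplicity j f * recip L * inv μA>0                  ≈⟨ *-congˡ (inv-unique μA>0 inverse) ⟩
        multiplicity j f * recip L * (fromℕ L * recip (suc k))
          ≈⟨ solve 4 (λ m r l s → m :* r :* (l :* s) := m :* s :* (r :* l)) refl _ _ _ _ ⟩
        multiplicity j f * recip (suc k) * (recip L * fromℕ L) ≈⟨ *-congˡ (recip-inverseˡ L) ⟩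
        multiplicity j f * recip (suc k) * 1#                  ≈⟨ *-identityʳ _ ⟩
        multiplicity j f * recip (suc k)                       ∎)
        where
        inverse : fromℕ L * recip (suc k) * measure (empirical f) A ≈ 1#
        inverse = begin-equality
          fromℕ L * recip (suc k) * measure (empirical f) A          ≈⟨ *-congˡ μA≈ ⟩
          fromℕ L * recip (suc k) * (fromℕ (suc k) * recip L)
            ≈⟨ solve 4 (λ l s k r → l :* s :* (k :* r) := (l :* r) :* (s :* k)) refl _ _ _ _ ⟩
          fromℕ L * recip L * (recip (suc k) * fromℕ (suc k))
            ≈⟨ *-cong (recip-inverseʳ L) (recip-inverseˡ (suc k)) ⟩
          1# * 1#                                                    ≈⟨ *-identityˡ 1# ⟩
          1#                                                         ∎

      null : ∀ A → Nonempty A → measure (empirical f) A ≈ 0# →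
             ∀ j → j ∈ A → empiricalOracle f A j ≈ recip ∣ A ∣
      null A _ μA≈0 j j∈A rewrite ∈⇒lookup j∈A with count (lookup A) f | measure-empirical f A
      ... | zero  | _   = refl
      ... | suc k | μA≈ = contradiction (fromℕ-pos k) (<-irrefl (sym (begin-equality
        fromℕ (suc k)                        ≈⟨ *-identityʳ _ ⟨
        fromℕ (suc k) * 1#                   ≈⟨ *-congˡ (recip-inverseˡ L) ⟨
        fromℕ (suc k) * (recip L * fromℕ L)  ≈⟨ *-assoc _ _ _ ⟨
        fromℕ (suc k) * recip L * fromℕ L    ≈⟨ *-congʳ (trans (sym μA≈) μA≈0) ⟩
        0# * fromℕ L                         ≈⟨ zeroˡ _ ⟩
        0#                                   ∎)))

      outside : ∀ A → Nonempty A → ∀ j → j ∉ A → empiricalOracle f A j ≈ 0#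
      outside A _ j j∉A rewrite ∉⇒lookup j∉A = refl

    uniform-isDistribution : IsDistribution (uniform n)
    uniform-isDistribution = (λ _ → recip-nonneg n) , trans (sum-const n (recip n)) (recip-inverseʳ n)

    measure-uniform : ∀ A → measure (uniform n) A ≈ fromℕ ∣ A ∣ * recip n
    measure-uniform A = trans (sum-cong λ x → if-indicator (lookup A x))
      (trans (sym (Sum.*-distribʳ-sum _ (λ x → indicator (lookup A x)))) (*-congʳ (sum-indicator-lookup A)))

    uniformOracle-isConditional : IsConditionalOracle (uniform n) uniformOracle
    uniformOracle-isConditional = record { positive = positive ; null = null ; outside = outside }
      where
      positive : ∀ A → Nonempty A → (μA>0 : 0# < measure (uniform n) A) →
                 ∀ j → j ∈ A → uniformOracle A j ≈ recip n * inv μA>0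
      positive A A≠∅ μA>0 j j∈A rewrite ∈⇒lookup j∈A = sym (begin-equality
        recip n * inv μA>0                   ≈⟨ *-congˡ (inv-unique μA>0 inverse) ⟩
        recip n * (fromℕ n * recip ∣ A ∣)    ≈⟨ *-assoc _ _ _ ⟨
        recip n * fromℕ n * recip ∣ A ∣      ≈⟨ *-congʳ (recip-inverseˡ n) ⟩
        1# * recip ∣ A ∣                     ≈⟨ *-identityˡ _ ⟩
        recip ∣ A ∣                          ∎)
        where
        instance _ = ∣A∣-nonZero A≠∅
        inverse : fromℕ n * recip ∣ A ∣ * measure (uniform n) A ≈ 1#
        inverse = begin-equality
          fromℕ n * recip ∣ A ∣ * measure (uniform n) A          ≈⟨ *-congˡ (measure-uniform A) ⟩
          fromℕ n * recip ∣ A ∣ * (fromℕ ∣ A ∣ * recip n)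
            ≈⟨ solve 4 (λ l s k r → l :* s :* (k :* r) := (l :* r) :* (s :* k)) refl _ _ _ _ ⟩
          fromℕ n * recip n * (recip ∣ A ∣ * fromℕ ∣ A ∣)
            ≈⟨ *-cong (recip-inverseʳ n) (recip-inverseˡ ∣ A ∣) ⟩
          1# * 1#                                                ≈⟨ *-identityˡ 1# ⟩
          1#                                                     ∎

      null : ∀ A → Nonempty A → measure (uniform n) A ≈ 0# → ∀ j → j ∈ A → uniformOracle A j ≈ recip ∣ A ∣
      null A _ _ j j∈A rewrite ∈⇒lookup j∈A = refl

      outside : ∀ A → Nonempty A → ∀ j → j ∉ A → uniformOracle A j ≈ 0#
      outside A _ j j∉A rewrite ∉⇒lookup j∉A = refl

    sum-uniformOracle : ∀ A → Nonempty A → sum (uniformOracle A) ≈ 1#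
    sum-uniformOracle A A≠∅ = begin-equality
      sum (uniformOracle A)                              ≈⟨ sum-cong (λ x → if-indicator (lookup A x)) ⟩
      sum (λ x → indicator (lookup A x) * recip ∣ A ∣)   ≈⟨ Sum.*-distribʳ-sum _ (λ x → indicator (lookup A x)) ⟨
      sum (λ x → indicator (lookup A x)) * recip ∣ A ∣   ≈⟨ *-congʳ (sum-indicator-lookup A) ⟩
      fromℕ ∣ A ∣ * recip ∣ A ∣                          ≈⟨ recip-inverseʳ ∣ A ∣ ⟩
      1#                                                 ∎
      where instance _ = ∣A∣-nonZero A≠∅

    sum-empiricalOracle : ∀ f A → Nonempty A → sum (empiricalOracle f A) ≈ 1#
    sum-empiricalOracle f A A≠∅ with count (lookup A) f | sum-multiplicity (lookup A) f
    ... | zero  | _  = sum-uniformOracle A A≠∅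
    ... | suc k | eq = begin-equality
      sum (λ x → if lookup A x then multiplicity x f * recip (suc k) else 0#)
        ≈⟨ sum-cong (λ x → trans (if-indicator (lookup A x)) (sym (*-assoc _ _ _))) ⟩
      sum (λ x → indicator (lookup A x) * multiplicity x f * recip (suc k))
        ≈⟨ Sum.*-distribʳ-sum _ (λ x → indicator (lookup A x) * multiplicity x f) ⟨
      sum (λ x → indicator (lookup A x) * multiplicity x f) * recip (suc k)
        ≈⟨ *-congʳ eq ⟩
      fromℕ (suc k) * recip (suc k)
        ≈⟨ recip-inverseʳ (suc k) ⟩
      1# ∎

    empiricalOracle-nonneg : ∀ f A j → 0# ≤ empiricalOracle f A j
    empiricalOracle-nonneg f A j with lookup A j | count (lookup A) f
    ... | false | _     = ≤-refl
    ... | true  | zero  = recip-nonneg ∣ A ∣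
    ... | true  | suc k = *-nonneg (fromℕ-nonneg (count _ f)) (recip-nonneg (suc k))

    uniformOracle-nonneg : ∀ A j → 0# ≤ uniformOracle A j
    uniformOracle-nonneg A j with lookup A j
    ... | false = ≤-refl
    ... | true  = recip-nonneg ∣ A ∣

    -- A point that f misses contributes 1 / n to the distance, and f misses all
    -- but at most length f points.
    empirical-far : ∀ f → length f ℕ.* 2 ℕ.≤ n →
                    recip 2 * recip 2 ≤ variationDistance (empirical f) (uniform n)
    empirical-far f 2L≤n = *-monoʳ-≤ (recip-nonneg 2) (+-cancelʳ-≤ (recip 2) (begin
      recip 2 + recip 2          ≈⟨ halves ⟩
      1#                         ≈⟨ trans (sum-const n (recip n)) (recip-inverseʳ n) ⟨
      sum {n} (λ _ → recip n)    ≤⟨ sum-mono pointwise ⟩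
      sum (λ x → gap x + multiplicity x f * recip n)
        ≈⟨ trans (Sum.∑-distrib-+ gap _) (+-congˡ
             (trans (sym (Sum.*-distribʳ-sum _ (λ x → multiplicity x f))) (*-congʳ (sum-multiplicity-all f)))) ⟩
      sum gap + fromℕ (length f) * recip n
        ≤⟨ +-monoʳ-≤ _ (≤-trans (cross-multiply (length f) 2 n 1 (≡.subst (length f ℕ.* 2 ℕ.≤_) (≡.sym (ℕₚ.*-identityˡ n)) 2L≤n))
             (≤-reflexive (trans (*-congʳ fromℕ-1) (*-identityˡ _)))) ⟩
      sum gap + recip 2          ∎))
      where
      gap : Fin n → Carrier
      gap x = abs (empirical f x - recip n)
      halves : recip 2 + recip 2 ≈ 1#
      halves = trans (solve 1 (λ r → r :+ r := (con 1 :+ (con 1 :+ con 0)) :* r) refl (recip 2)) (recip-inverseʳ 2)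
      pointwise : ∀ x → recip n ≤ gap x + multiplicity x f * recip n
      pointwise x with count (λ y → does (x ≟ y)) f
      ... | zero  = begin
        recip n                                     ≈⟨ +-identityˡ _ ⟨
        0# + recip n                                ≈⟨ +-cong -0#≈0# (-‿involutive (recip n)) ⟨
        - 0# + - (- recip n)                        ≈⟨ -‿+-comm 0# (- recip n) ⟩
        - (0# - recip n)                            ≈⟨ -‿cong (+-congʳ (zeroˡ _)) ⟨
        - (0# * recip (length f) - recip n)         ≤⟨ proj₁ (proj₂ (supremum _ _)) ⟩
        abs (0# * recip (length f) - recip n)       ≤⟨ x≤x+y (≤-reflexive (sym (zeroˡ _))) ⟩
        abs (0# * recip (length f) - recip n) + 0# * recip n ∎
        where open Ring using (-0#≈0#; -‿involutive; -‿+-comm)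
      ... | suc k = begin
        recip n                                     ≈⟨ *-identityˡ _ ⟨
        1# * recip n
          ≤⟨ *-monoˡ-≤ (recip-nonneg n) (x≤x+y (fromℕ-nonneg k)) ⟩
        fromℕ (suc k) * recip n                     ≤⟨ x≤x+y (abs-nonneg _) ⟩
        fromℕ (suc k) * recip n + abs (fromℕ (suc k) * recip (length f) - recip n)  ≈⟨ +-comm _ _ ⟩
        abs (fromℕ (suc k) * recip (length f) - recip n) + fromℕ (suc k) * recip n  ∎

  -- Comparison of the answer probabilities

  -- At M points a set A has relative expected load M ∣A∣ / n; Scaled true says
  -- that this is at least Q, Scaled false that it is at most 1 / Q.
  Scaled : ℕ → ℕ → ∀ {n} → Bool → Subset n → Set
  Scaled M Q {n} true  A = Q ℕ.* n ℕ.≤ M ℕ.* ∣ A ∣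
  Scaled M Q {n} false A = M ℕ.* ∣ A ∣ ℕ.* Q ℕ.≤ n

  module Comparison (n : ℕ) .{{_ : ℕ.NonZero n}} (t M Q : ℕ)
                    .{{_ : ℕ.NonZero M}} .{{_ : ℕ.NonZero Q}} where
    open Expectation n
    open Oracles n

    T : Carrier
    T = fromℕ (suc t)

    -- suc x in place of x, so that a large set containing no point needs no separate
    -- treatment.
    answerFactor : Bool → Subset n → ℕ → Carrier
    answerFactor true  A x       = recip (suc x)
    answerFactor false A zero    = recip ∣ A ∣
    answerFactor false A (suc x) = 0#

    idealFactor : Bool → Subset n → Carrier
    idealFactor true  A = fromℕ n * recip (M ℕ.* ∣ A ∣)
    idealFactor false A = recip ∣ A ∣

    pointFactor : Bool → Carrier
    pointFactor b = if b then fromℕ M * recip n else 1#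

    -- For a large set, its count relative to the mean; for a small one, a penalty
    -- that outweighs everything else as soon as the set is hit.
    load : Bool → Subset n → ℕ → Carrier
    load true  A x = fromℕ (suc x) * (fromℕ n * recip (M ℕ.* ∣ A ∣))
    load false A x = 1# + T * fromℕ x

    error : Bool → Subset n → List (Fin n) → Carrier
    error true  A s = fromℕ (suc (t ℕ.+ t)) * recip Q
    error false A s = T * (fromℕ (count (lookup A) s) + T * recip Q)

    answerFactor-nonneg : ∀ b A x → 0# ≤ answerFactor b A x
    answerFactor-nonneg true  A x       = recip-nonneg (suc x)
    answerFactor-nonneg false A zero    = recip-nonneg ∣ A ∣
    answerFactor-nonneg false A (suc x) = ≤-refl

    idealFactor-nonneg : ∀ b A → 0# ≤ idealFactor b A
    idealFactor-nonneg true  A = *-nonneg (fromℕ-nonneg n) (recip-nonneg (M ℕ.* ∣ A ∣))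
    idealFactor-nonneg false A = recip-nonneg ∣ A ∣

    pointFactor-nonneg : ∀ b → 0# ≤ pointFactor b
    pointFactor-nonneg b = if-nonneg b (*-nonneg (fromℕ-nonneg M) (recip-nonneg n)) 0≤1

    load-nonneg : ∀ b A x → 0# ≤ load b A x
    load-nonneg true  A x = *-nonneg (fromℕ-nonneg (suc x)) (idealFactor-nonneg true A)
    load-nonneg false A x = +-nonneg 0≤1 (*-nonneg (fromℕ-nonneg (suc t)) (fromℕ-nonneg x))

    error-nonneg : ∀ b A s → 0# ≤ error b A s
    error-nonneg true  A s = *-nonneg (fromℕ-nonneg (suc (t ℕ.+ t))) (recip-nonneg Q)
    error-nonneg false A s = *-nonneg (fromℕ-nonneg (suc t))
      (+-nonneg (fromℕ-nonneg (count _ s)) (*-nonneg (fromℕ-nonneg (suc t)) (recip-nonneg Q)))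

    pointFactor*idealFactor : ∀ b A → Nonempty A → pointFactor b * idealFactor b A ≈ recip ∣ A ∣
    pointFactor*idealFactor false A A≠∅ = *-identityˡ _
    pointFactor*idealFactor true  A A≠∅ = begin-equality
      fromℕ M * recip n * (fromℕ n * recip (M ℕ.* ∣ A ∣))    ≈⟨ *-congˡ (*-congˡ (recip-* M ∣ A ∣)) ⟩
      fromℕ M * recip n * (fromℕ n * (recip M * recip ∣ A ∣))
        ≈⟨ solve 5 (λ m r n s a → m :* r :* (n :* (s :* a)) := (m :* s) :* (r :* n) :* a) refl _ _ _ _ _ ⟩
      fromℕ M * recip M * (recip n * fromℕ n) * recip ∣ A ∣
        ≈⟨ *-congʳ (*-cong (recip-inverseʳ M) (recip-inverseˡ n)) ⟩
      1# * 1# * recip ∣ A ∣                                  ≈⟨ trans (*-assoc _ _ _) (trans (*-identityˡ _) (*-identityˡ _)) ⟩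
      recip ∣ A ∣                                            ∎
      where instance _ = ∣A∣-nonZero A≠∅

    uniformOracle-factors : ∀ b A → Nonempty A → ∀ j →
      indicator (lookup A j) * (pointFactor b * idealFactor b A) ≈ uniformOracle A j
    uniformOracle-factors b A A≠∅ j =
      trans (*-congˡ (pointFactor*idealFactor b A A≠∅)) (sym (if-indicator (lookup A j)))

    multiplicity≤count : ∀ (A : Subset n) j → lookup A j ≡ true → ∀ f → count (λ x → does (j ≟ x)) f ℕ.≤ count (lookup A) f
    multiplicity≤count A j j∈A []      = z≤n
    multiplicity≤count A j j∈A (x ∷ f) with j ≟ x
    ... | yes ≡.refl rewrite j∈A = s≤s (multiplicity≤count A j j∈A f)
    ... | no _ with lookup A x
    ...   | true  = ℕₚ.m≤n⇒m≤1+n (multiplicity≤count A j j∈A f)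
    ...   | false = multiplicity≤count A j j∈A f

    empiricalOracle-factors : ∀ b A j f →
      indicator (lookup A j) * ((if b then multiplicity j f else 1#) * answerFactor b A (count (lookup A) f))
      ≤ empiricalOracle f A j
    empiricalOracle-factors b A j f with lookup A j in eq
    ... | false = ≤-reflexive (zeroˡ _)
    ... | true  = ≤-trans (≤-reflexive (*-identityˡ _)) (bound b (count (lookup A) f) (multiplicity≤count A j eq f))
      where
      bound : ∀ b x → count (λ y → does (j ≟ y)) f ℕ.≤ x →
              (if b then multiplicity j f else 1#) * answerFactor b A x ≤ conditional f A j x
      bound true zero le = begin
        multiplicity j f * recip 1  ≈⟨ *-congʳ (reflexive (≡.cong fromℕ (ℕₚ.n≤0⇒n≡0 le))) ⟩
        0# * recip 1                ≈⟨ zeroˡ _ ⟩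
        0#                          ≤⟨ recip-nonneg ∣ A ∣ ⟩
        recip ∣ A ∣                 ∎
      bound true  (suc x) _ = *-monoʳ-≤ (fromℕ-nonneg (count _ f)) (recip-antitone (ℕₚ.n≤1+n (suc x)))
      bound false zero    _ = ≤-reflexive (*-identityˡ _)
      bound false (suc x) _ = ≤-trans (≤-reflexive (zeroʳ _))
        (*-nonneg (fromℕ-nonneg (count _ f)) (recip-nonneg (suc x)))

    module Queries (A : Fin t → Subset n) (A≠∅ : ∀ i → Nonempty (A i)) (b : Fin t → Bool)
                   (scaled : ∀ i → Scaled M Q (b i) (A i)) where

      answers : List (Fin n) → Carrier
      answers f = product λ i → answerFactor (b i) (A i) (count (lookup (A i)) f)

      ideal : Carrier
      ideal = product λ i → idealFactor (b i) (A i)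

      totalLoad : List (Fin n) → Carrier
      totalLoad f = sum λ i → load (b i) (A i) (count (lookup (A i)) f)

      answers-symmetric : Symmetric answers
      answers-symmetric r = product-cong λ i →
        reflexive (≡.cong (answerFactor (b i) (A i)) (count-↭ (lookup (A i)) r))

      answers-nonneg : ∀ f → 0# ≤ answers f
      answers-nonneg f = product-nonneg λ i → answerFactor-nonneg (b i) (A i) _

      ideal-nonneg : 0# ≤ ideal
      ideal-nonneg = product-nonneg λ i → idealFactor-nonneg (b i) (A i)

      -- Jensen's inequality for the answer probabilities, as a tangent bound that is
      -- linear in the counts; if f hits a set that should be missed, the load
      -- of that set alone makes the bound trivial.
      ideal≤answers+load : ∀ f → T * ideal ≤ answers f + ideal * totalLoad f
      ideal≤answers+load f with any? (λ i → (b i ≟ᵇ false) ×-dec ¬? (count (lookup (A i)) f ℕ.≟ 0))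
      ... | yes (i , bᵢ≡false , hit) = begin
        T * ideal                    ≈⟨ *-comm _ _ ⟩
        ideal * T                    ≤⟨ *-monoʳ-≤ ideal-nonneg (≤-trans (heavy (b i) _ bᵢ≡false hit)
          (term≤sum (λ i → load-nonneg (b i) (A i) (count (lookup (A i)) f)) i)) ⟩
        ideal * totalLoad f          ≤⟨ x≤x+y (answers-nonneg f) ⟩
        ideal * totalLoad f + answers f  ≈⟨ +-comm _ _ ⟩
        answers f + ideal * totalLoad f  ∎
        where
        heavy : ∀ c x → c ≡ false → x ≢ 0 → T ≤ load c (A i) x
        heavy false zero    _ x≢0 = contradiction ≡.refl x≢0
        heavy false (suc x) _ _   = begin
          T                     ≈⟨ *-identityʳ T ⟨
          T * 1#                ≤⟨ *-monoʳ-≤ (fromℕ-nonneg (suc t)) (x≤x+y (fromℕ-nonneg x)) ⟩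
          T * fromℕ (suc x)     ≤⟨ x≤x+y 0≤1 ⟩
          T * fromℕ (suc x) + 1# ≈⟨ +-comm _ _ ⟩
          1# + T * fromℕ (suc x) ∎
      ... | no none = begin
        T * ideal                                  ≈⟨ *-congˡ ideal≈ ⟩
        T * (answers f * product y)                ≈⟨ solve 3 (λ T a p → T :* (a :* p) := a :* (T :* p)) refl T (answers f) (product y) ⟩
        answers f * (T * product y)                ≤⟨ *-monoʳ-≤ (answers-nonneg f) (am-gm-tangent t y-nonneg) ⟩
        answers f * (1# + product y * sum y)       ≈⟨ solve 3 (λ a p s → a :* (con 1 :+ p :* s) := a :+ a :* p :* s) refl (answers f) (product y) (sum y) ⟩
        answers f + answers f * product y * sum y  ≈⟨ +-congˡ (*-congʳ ideal≈) ⟨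
        answers f + ideal * sum y                  ≤⟨ +-monoʳ-≤ _ (*-monoʳ-≤ ideal-nonneg (sum-mono λ i → ratio≤load (b i) (A i) _)) ⟩
        answers f + ideal * totalLoad f            ∎
        where
        ratio : Bool → Subset n → ℕ → Carrier
        ratio true  A x = load true A x
        ratio false A x = 1#
        ratio≤load : ∀ c A x → ratio c A x ≤ load c A x
        ratio≤load true  A x = ≤-refl
        ratio≤load false A x = x≤x+y (*-nonneg (fromℕ-nonneg (suc t)) (fromℕ-nonneg x))
        ratio-nonneg : ∀ c A x → 0# ≤ ratio c A x
        ratio-nonneg true  A x = load-nonneg true A x
        ratio-nonneg false A x = 0≤1
        y : Fin t → Carrier
        y i = ratio (b i) (A i) (count (lookup (A i)) f)
        y-nonneg : ∀ i → 0# ≤ y i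
        y-nonneg i = ratio-nonneg (b i) (A i) _
        balance : ∀ c A x → (c ≡ false → x ≡ 0) → idealFactor c A ≈ answerFactor c A x * ratio c A x
        balance true  A x       _ = sym (trans (sym (*-assoc _ _ _))
          (trans (*-congʳ (recip-inverseˡ (suc x))) (*-identityˡ _)))
        balance false A zero    _ = sym (*-identityʳ _)
        balance false A (suc x) h = contradiction (h ≡.refl) λ ()
        missed : ∀ i → b i ≡ false → count (lookup (A i)) f ≡ 0
        missed i bᵢ≡false with count (lookup (A i)) f in eq
        ... | zero  = ≡.refl
        ... | suc k = contradiction (i , bᵢ≡false , λ x≡0 → contradiction (≡.trans (≡.sym eq) x≡0) λ ()) none
        ideal≈ : ideal ≈ answers f * product y
        ideal≈ = trans (product-cong λ i → balance (b i) (A i) _ (missed i)) (product-* {t} _ _)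

      𝔼-load : ∀ c B s e → Nonempty B → Scaled M Q c B → e ℕ.≤ t → length s ℕ.≤ t →
               𝔼 (e ℕ.+ M) (λ f → load c B (count (lookup B) (s ++ f))) ≤ 1# + error c B s
      𝔼-load c B s e B≠∅ sc e≤t s≤t = lemma c sc
        where
        instance
          _ = ∣A∣-nonZero B≠∅
          _ = ℕₚ.m*n≢0 M ∣ B ∣
        p = lookup B
        ν = recip n * fromℕ ∣ B ∣
        mean : 𝔼 (e ℕ.+ M) (λ f → fromℕ (count p f)) ≈ fromℕ (e ℕ.+ M) * ν
        mean = trans (𝔼-count (e ℕ.+ M) p) (*-congˡ (*-congˡ (sum-indicator-lookup B)))
        ν≤1 : ν ≤ 1#
        ν≤1 = ≤-trans (*-monoʳ-≤ (recip-nonneg n) (fromℕ-mono-≤ (∣p∣≤n B))) (≤-reflexive (recip-inverseˡ n))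
        lemma : ∀ c → Scaled M Q c B → 𝔼 (e ℕ.+ M) (λ f → load c B (count p (s ++ f))) ≤ 1# + error c B s
        lemma true sc = begin
          𝔼 (e ℕ.+ M) (λ f → fromℕ (suc (count p (s ++ f))) * α)
            ≈⟨ 𝔼-cong (e ℕ.+ M) (λ f → trans (*-congʳ (trans (reflexive (≡.cong (fromℕ ∘ suc) (count-++ p s f)))
                 (fromℕ-+ (suc (count p s)) (count p f)))) (*-comm _ _)) ⟩
          𝔼 (e ℕ.+ M) (λ f → α * (S + fromℕ (count p f)))
            ≈⟨ trans (𝔼-*ˡ (e ℕ.+ M) α _) (*-congˡ (trans (𝔼-+ (e ℕ.+ M) _ _) (+-cong (𝔼-const (e ℕ.+ M) S) mean))) ⟩
          α * (S + fromℕ (e ℕ.+ M) * ν)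
            ≈⟨ trans (*-congˡ (+-congˡ (*-congʳ (fromℕ-+ e M))))
                 (solve 5 (λ α S e m ν → α :* (S :+ (e :+ m) :* ν) := m :* ν :* α :+ (S :+ e :* ν) :* α)
                    refl α S (fromℕ e) (fromℕ M) ν) ⟩
          fromℕ M * ν * α + (S + fromℕ e * ν) * α
            ≤⟨ +-mono-≤ (≤-reflexive balanced) (*-mono-≤ (idealFactor-nonneg true B) (fromℕ-nonneg (suc (t ℕ.+ t)))
                 few α≤) ⟩
          1# + fromℕ (suc (t ℕ.+ t)) * recip Q ∎
          where
          α = fromℕ n * recip (M ℕ.* ∣ B ∣)
          S = fromℕ (suc (count p s))
          balanced : fromℕ M * ν * α ≈ 1#
          balanced = begin-equality
            fromℕ M * (recip n * fromℕ ∣ B ∣) * (fromℕ n * recip (M ℕ.* ∣ B ∣))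
              ≈⟨ solve 5 (λ m r s n q → m :* (r :* s) :* (n :* q) := (r :* n) :* (m :* s :* q)) refl _ _ _ _ _ ⟩
            recip n * fromℕ n * (fromℕ M * fromℕ ∣ B ∣ * recip (M ℕ.* ∣ B ∣))
              ≈⟨ *-cong (recip-inverseˡ n) (trans (*-congʳ (sym (fromℕ-* M ∣ B ∣))) (recip-inverseʳ (M ℕ.* ∣ B ∣))) ⟩
            1# * 1#  ≈⟨ *-identityˡ 1# ⟩
            1#       ∎
          α≤ : α ≤ recip Q
          α≤ = ≤-trans (cross-multiply n Q (M ℕ.* ∣ B ∣) 1 (≡.subst₂ ℕ._≤_ (ℕₚ.*-comm Q n) (≡.sym (ℕₚ.*-identityˡ _)) sc))
            (≤-reflexive (trans (*-congʳ fromℕ-1) (*-identityˡ _)))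
          few : S + fromℕ e * ν ≤ fromℕ (suc (t ℕ.+ t))
          few = begin
            S + fromℕ e * ν          ≤⟨ +-mono-≤ (fromℕ-mono-≤ (s≤s (ℕₚ.≤-trans (count≤length p s) s≤t)))
              (≤-trans (*-monoʳ-≤ (fromℕ-nonneg e) ν≤1) (≤-trans (≤-reflexive (*-identityʳ _)) (fromℕ-mono-≤ e≤t))) ⟩
            fromℕ (suc t) + fromℕ t  ≈⟨ fromℕ-+ (suc t) t ⟨
            fromℕ (suc t ℕ.+ t)      ∎
        lemma false sc = begin
          𝔼 (e ℕ.+ M) (λ f → 1# + T * fromℕ (count p (s ++ f)))
            ≈⟨ trans (𝔼-+ (e ℕ.+ M) _ _) (+-cong (𝔼-const (e ℕ.+ M) 1#) (𝔼-*ˡ (e ℕ.+ M) T _)) ⟩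
          1# + T * 𝔼 (e ℕ.+ M) (λ f → fromℕ (count p (s ++ f)))
            ≈⟨ +-congˡ (*-congˡ (trans (𝔼-cong (e ℕ.+ M) (λ f → trans (reflexive (≡.cong fromℕ (count-++ p s f)))
                 (fromℕ-+ (count p s) (count p f))))
                 (trans (𝔼-+ (e ℕ.+ M) _ _) (+-cong (𝔼-const (e ℕ.+ M) _) mean)))) ⟩
          1# + T * (fromℕ (count p s) + fromℕ (e ℕ.+ M) * ν)
            ≤⟨ +-monoʳ-≤ 1# (*-monoʳ-≤ (fromℕ-nonneg (suc t)) (+-monoʳ-≤ _ rare)) ⟩
          1# + T * (fromℕ (count p s) + T * recip Q) ∎
          where
          rare : fromℕ (e ℕ.+ M) * ν ≤ T * recip Q
          rare = begin
            fromℕ (e ℕ.+ M) * ν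
              ≈⟨ solve 3 (λ e r s → e :* (r :* s) := e :* s :* r) refl _ _ _ ⟩
            fromℕ (e ℕ.+ M) * fromℕ ∣ B ∣ * recip n  ≈⟨ *-congʳ (fromℕ-* (e ℕ.+ M) ∣ B ∣) ⟨
            fromℕ ((e ℕ.+ M) ℕ.* ∣ B ∣) * recip n
              ≤⟨ cross-multiply ((e ℕ.+ M) ℕ.* ∣ B ∣) Q n (suc t) bound ⟩
            T * recip Q ∎
            where
            grow : e ℕ.+ M ℕ.≤ suc t ℕ.* M
            grow = ℕₚ.≤-trans (ℕₚ.+-monoˡ-≤ M (ℕₚ.≤-trans e≤t (ℕₚ.m≤m*n t M))) (ℕₚ.≤-reflexive (ℕₚ.+-comm (t ℕ.* M) M))
            bound : (e ℕ.+ M) ℕ.* ∣ B ∣ ℕ.* Q ℕ.≤ suc t ℕ.* n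
            bound = ℕₚ.≤-trans (ℕₚ.*-monoˡ-≤ Q (ℕₚ.*-monoˡ-≤ ∣ B ∣ grow))
              (ℕₚ.≤-trans (ℕₚ.≤-reflexive (≡.trans (≡.cong (ℕ._* Q) (ℕₚ.*-assoc (suc t) M ∣ B ∣)) (ℕₚ.*-assoc (suc t) (M ℕ.* ∣ B ∣) Q)))
                (ℕₚ.*-monoʳ-≤ (suc t) sc))

      unselected≤ : ∀ {k} (c : Fin k → Bool) → unselected c ℕ.≤ k
      unselected≤ {zero}  c = z≤n
      unselected≤ {suc k} c with c zero
      ... | true  = ℕₚ.m≤n⇒m≤1+n (unselected≤ (c ∘ suc))
      ... | false = s≤s (unselected≤ (c ∘ suc))

      length-select≤ : ∀ {k} (c : Fin k → Bool) js → length (select c js) ℕ.≤ k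
      length-select≤ {zero}  c js = z≤n
      length-select≤ {suc k} c js with c zero
      ... | true  = s≤s (length-select≤ (c ∘ suc) (js ∘ suc))
      ... | false = ℕₚ.m≤n⇒m≤1+n (length-select≤ (c ∘ suc) (js ∘ suc))

      totalError : (Fin t → Fin n) → Carrier
      totalError js = sum λ i → error (b i) (A i) (select b js)

      ideal≤𝔼-answers : ∀ js → ideal ≤ 𝔼 (unselected b ℕ.+ M) (λ f → answers (select b js ++ f)) + ideal * totalError js
      ideal≤𝔼-answers js = +-cancelʳ-≤ (ideal * fromℕ t) (begin
        ideal + ideal * fromℕ t
          ≈⟨ solve 2 (λ c t → c :+ c :* t := (con 1 :+ t) :* c) refl ideal (fromℕ t) ⟩
        T * ideal
          ≈⟨ 𝔼-const m _ ⟨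
        𝔼 m (λ f → T * ideal)
          ≤⟨ 𝔼-mono m (λ f _ → ideal≤answers+load (s ++ f)) ⟩
        𝔼 m (λ f → answers (s ++ f) + ideal * totalLoad (s ++ f))
          ≈⟨ trans (𝔼-+ m _ _) (+-congˡ (trans (𝔼-*ˡ m ideal _) (*-congˡ (𝔼-sum m {t} _)))) ⟩
        E + ideal * sum (λ i → 𝔼 m (λ f → load (b i) (A i) (count (lookup (A i)) (s ++ f))))
          ≤⟨ +-monoʳ-≤ E (*-monoʳ-≤ ideal-nonneg (sum-mono λ i →
               𝔼-load (b i) (A i) s (unselected b) (A≠∅ i) (scaled i) (unselected≤ b) (length-select≤ b js))) ⟩
        E + ideal * sum (λ i → 1# + error (b i) (A i) s)
          ≈⟨ +-congˡ (*-congˡ (trans (Sum.∑-distrib-+ {t} _ _) (+-congʳ (trans (sum-const t 1#) (*-identityʳ _))))) ⟩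
        E + ideal * (fromℕ t + totalError js)
          ≈⟨ solve 4 (λ E c t r → E :+ c :* (t :+ r) := E :+ c :* r :+ c :* t) refl E ideal (fromℕ t) (totalError js) ⟩
        E + ideal * totalError js + ideal * fromℕ t ∎)
        where
        s = select b js
        m = unselected b ℕ.+ M
        E = 𝔼 m (λ f → answers (s ++ f))

      uniformOracle≤𝔼-empiricalOracle : ∀ js →
        product (λ i → uniformOracle (A i) (js i))
        ≤ 𝔼 (t ℕ.+ M) (λ f → product λ i → empiricalOracle f (A i) (js i))
          + product (λ i → uniformOracle (A i) (js i)) * totalError js
      uniformOracle≤𝔼-empiricalOracle js = begin
        product (λ i → uniformOracle (A i) (js i))
          ≈⟨ factored ⟩
        I * (F * ideal)
          ≤⟨ *-monoʳ-≤ 0≤I (*-monoʳ-≤ 0≤F (ideal≤𝔼-answers js)) ⟩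
        I * (F * (E + ideal * totalError js))
          ≈⟨ solve 5 (λ I F E c r → I :* (F :* (E :+ c :* r)) := I :* (F :* E) :+ I :* (F :* c) :* r)
               refl I F E ideal (totalError js) ⟩
        I * (F * E) + I * (F * ideal) * totalError js
          ≤⟨ +-mono-≤ (≤-trans (*-monoʳ-≤ 0≤I (𝔼-multiplicities b js M answers-symmetric answers-nonneg)) collect)
               (≤-reflexive (*-congʳ (sym factored))) ⟩
        𝔼 (t ℕ.+ M) (λ f → product λ i → empiricalOracle f (A i) (js i))
          + product (λ i → uniformOracle (A i) (js i)) * totalError js ∎
        where
        ind : Fin t → Carrier
        ind i = indicator (lookup (A i) (js i))
        I = product ind
        F = product (pointFactor ∘ b)
        E = 𝔼 (unselected b ℕ.+ M) (λ f → answers (select b js ++ f))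
        0≤I : 0# ≤ I
        0≤I = product-nonneg λ i → indicator-nonneg (lookup (A i) (js i))
        0≤F : 0# ≤ F
        0≤F = product-nonneg λ i → pointFactor-nonneg (b i)
        factored : product (λ i → uniformOracle (A i) (js i)) ≈ I * (F * ideal)
        factored = begin-equality
          product (λ i → uniformOracle (A i) (js i))
            ≈⟨ product-cong (λ i → sym (uniformOracle-factors (b i) (A i) (A≠∅ i) (js i))) ⟩
          product (λ i → ind i * (pointFactor (b i) * idealFactor (b i) (A i)))
            ≈⟨ product-* {t} _ _ ⟩
          I * product (λ i → pointFactor (b i) * idealFactor (b i) (A i))
            ≈⟨ *-congˡ (product-* {t} _ _) ⟩
          I * (F * ideal) ∎
        mult : List (Fin n) → Fin t → Carrier
        mult f i = if b i then multiplicity (js i) f else 1#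
        mult-nonneg : ∀ f i → 0# ≤ mult f i
        mult-nonneg f i = if-nonneg (b i) (fromℕ-nonneg (count _ f)) 0≤1
        ans : List (Fin n) → Fin t → Carrier
        ans f i = answerFactor (b i) (A i) (count (lookup (A i)) f)
        collect : I * 𝔼 (t ℕ.+ M) (λ f → multiplicities b js f * answers f)
                  ≤ 𝔼 (t ℕ.+ M) (λ f → product λ i → empiricalOracle f (A i) (js i))
        collect = begin
          I * 𝔼 (t ℕ.+ M) (λ f → multiplicities b js f * answers f)
            ≈⟨ 𝔼-*ˡ (t ℕ.+ M) I _ ⟨
          𝔼 (t ℕ.+ M) (λ f → I * (multiplicities b js f * answers f))
            ≈⟨ 𝔼-cong (t ℕ.+ M) (λ f → *-congˡ (sym (product-* (mult f) (ans f)))) ⟩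
          𝔼 (t ℕ.+ M) (λ f → I * product (λ i → mult f i * ans f i))
            ≈⟨ 𝔼-cong (t ℕ.+ M) (λ f → sym (product-* ind (λ i → mult f i * ans f i))) ⟩
          𝔼 (t ℕ.+ M) (λ f → product (λ i → ind i * (mult f i * ans f i)))
            ≤⟨ 𝔼-mono (t ℕ.+ M) (λ f _ → product-mono
                 (λ i → *-nonneg (indicator-nonneg (lookup (A i) (js i))) (*-nonneg (mult-nonneg f i) (answerFactor-nonneg (b i) (A i) _)))
                 (λ i → empiricalOracle-factors (b i) (A i) (js i) f)) ⟩
          𝔼 (t ℕ.+ M) (λ f → product λ i → empiricalOracle f (A i) (js i)) ∎

  module _ {n : ℕ} where

    sumVec-mono : ∀ t {g h : Vec (Fin n) t → Carrier} → (∀ js → g js ≤ h js) → sumVec t g ≤ sumVec t h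
    sumVec-mono zero    g≤h = g≤h []
    sumVec-mono (suc t) g≤h = sum-mono λ j → sumVec-mono t λ js → g≤h (j ∷ js)

    sumVec-cong : ∀ t {g h : Vec (Fin n) t → Carrier} → (∀ js → g js ≈ h js) → sumVec t g ≈ sumVec t h
    sumVec-cong zero    g≈h = g≈h []
    sumVec-cong (suc t) g≈h = sum-cong λ j → sumVec-cong t λ js → g≈h (j ∷ js)

    sumVec-+ : ∀ t (g h : Vec (Fin n) t → Carrier) → sumVec t (λ js → g js + h js) ≈ sumVec t g + sumVec t h
    sumVec-+ zero    g h = refl
    sumVec-+ (suc t) g h = trans (sum-cong λ j → sumVec-+ t (g ∘ (j ∷_)) (h ∘ (j ∷_))) (Sum.∑-distrib-+ {n} _ _)

    sumVec-*ˡ : ∀ t x (g : Vec (Fin n) t → Carrier) → sumVec t (λ js → x * g js) ≈ x * sumVec t g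
    sumVec-*ˡ zero    x g = refl
    sumVec-*ˡ (suc t) x g = trans (sum-cong λ j → sumVec-*ˡ t x (g ∘ (j ∷_)))
      (sym (Sum.*-distribˡ-sum x (λ j → sumVec t (g ∘ (j ∷_)))))

    sumVec-sum : ∀ t {k} (g : Fin k → Vec (Fin n) t → Carrier) →
                 sumVec t (λ js → sum λ i → g i js) ≈ sum λ i → sumVec t (g i)
    sumVec-sum zero    g = refl
    sumVec-sum (suc t) {k} g = trans (sum-cong {n} λ j → sumVec-sum t λ i js → g i (j ∷ js)) (Sum.∑-comm {n} {k} _)

    independent : ∀ {t} → (Fin t → Fin n → Carrier) → Vec (Fin n) t → Carrier
    independent ν js = product λ i → ν i (lookup js i)

    sumVec-independent : ∀ t (ν : Fin t → Fin n → Carrier) → (∀ i → sum (ν i) ≈ 1#) →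
                         sumVec t (independent ν) ≈ 1#
    sumVec-independent zero    ν eq = refl
    sumVec-independent (suc t) ν eq = begin-equality
      sum (λ j → sumVec t λ js → ν zero j * independent (ν ∘ suc) js)
        ≈⟨ sum-cong (λ j → trans (sumVec-*ˡ t (ν zero j) (independent (ν ∘ suc)))
             (trans (*-congˡ (sumVec-independent t (ν ∘ suc) (eq ∘ suc))) (*-identityʳ _))) ⟩
      sum (ν zero)  ≈⟨ eq zero ⟩
      1#            ∎

    sumVec-marginal : ∀ t (ν : Fin t → Fin n → Carrier) → (∀ i → sum (ν i) ≈ 1#) → ∀ k (h : Fin n → Carrier) →
                      sumVec t (λ js → independent ν js * h (lookup js k)) ≈ sum λ x → ν k x * h x
    sumVec-marginal (suc t) ν eq zero h = sum-cong λ j → begin-equality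
      sumVec t (λ js → ν zero j * independent (ν ∘ suc) js * h j)
        ≈⟨ sumVec-cong t (λ js → solve 3 (λ a b c → a :* b :* c := a :* c :* b) refl (ν zero j) (independent (ν ∘ suc) js) (h j)) ⟩
      sumVec t (λ js → ν zero j * h j * independent (ν ∘ suc) js)
        ≈⟨ trans (sumVec-*ˡ t _ (independent (ν ∘ suc)))
             (trans (*-congˡ (sumVec-independent t (ν ∘ suc) (eq ∘ suc))) (*-identityʳ _)) ⟩
      ν zero j * h j ∎
    sumVec-marginal (suc t) ν eq (suc k) h = begin-equality
      sum (λ j → sumVec t λ js → ν zero j * independent (ν ∘ suc) js * h (lookup js k))
        ≈⟨ sum-cong (λ j → trans (sumVec-cong t λ js → *-assoc (ν zero j) (independent (ν ∘ suc) js) _) (trans (sumVec-*ˡ t (ν zero j) _)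
             (*-congˡ (sumVec-marginal t (ν ∘ suc) (eq ∘ suc) k h)))) ⟩
      sum (λ j → ν zero j * S)   ≈⟨ Sum.*-distribʳ-sum S (ν zero) ⟨
      sum (ν zero) * S           ≈⟨ trans (*-congʳ (eq zero)) (*-identityˡ S) ⟩
      S                          ∎
      where S = sum λ x → ν (suc k) x * h x

  sum-indicator-unique : ∀ {K} (p : Fin K → Bool) →
    (∀ k l → k Fin.< l → p k ≡ true → ¬ p l ≡ true) → sum (indicator ∘ p) ≤ 1#
  sum-indicator-unique {zero}  p unique = 0≤1
  sum-indicator-unique {suc K} p unique with p zero in eq
  ... | true  = ≤-reflexive (trans (+-congˡ (sum-zero {K} absent)) (+-identityʳ 1#))
    where
    absent : ∀ k → indicator (p (suc k)) ≈ 0#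
    absent k with p (suc k) in eq′
    ... | true  = contradiction eq′ (unique zero (suc k) (s≤s z≤n) eq)
    ... | false = refl
  ... | false = ≤-trans (≤-reflexive (+-identityˡ _))
    (sum-indicator-unique (p ∘ suc) λ k l k<l → unique (suc k) (suc l) (s≤s k<l))

  module Seed (n : ℕ) .{{_ : ℕ.NonZero n}} (t : ℕ) (A : Fin t → Subset n) (A≠∅ : ∀ i → Nonempty (A i))
              (accepts? : Vec (Fin n) t → Bool) (Q : ℕ) .{{_ : ℕ.NonZero Q}} where
    open Expectation n
    open Oracles n

    T : Carrier
    T = fromℕ (suc t)

    run : (Subset n → Fin n → Carrier) → Bool → Carrier
    run q v = sumVec t λ js → product (λ i → q (A i) (lookup js i)) * indicator (does (accepts? js ≟ᵇ v))

    run-total : ∀ q → (∀ i → sum (q (A i)) ≈ 1#) → run q true + run q false ≈ 1#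
    run-total q eq = begin-equality
      run q true + run q false
        ≈⟨ sumVec-+ t _ _ ⟨
      sumVec t (λ js → independent (q ∘ A) js * indicator (does (accepts? js ≟ᵇ true))
                       + independent (q ∘ A) js * indicator (does (accepts? js ≟ᵇ false)))
        ≈⟨ sumVec-cong t (λ js → trans (sym (distribˡ _ _ _)) (trans (*-congˡ (either (accepts? js))) (*-identityʳ _))) ⟩
      sumVec t (independent (q ∘ A))
        ≈⟨ sumVec-independent t (q ∘ A) eq ⟩
      1# ∎
      where
      either : ∀ v → indicator (does (v ≟ᵇ true)) + indicator (does (v ≟ᵇ false)) ≈ 1#
      either true  = +-identityʳ 1#
      either false = +-identityˡ 1#

    run-nonneg : ∀ q v → (∀ i j → 0# ≤ q (A i) j) → 0# ≤ run q v
    run-nonneg q v 0≤q = ≤-trans (≤-reflexive (sym (zero-sum t)))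
      (sumVec-mono t λ js → *-nonneg (product-nonneg λ i → 0≤q i (lookup js i)) (indicator-nonneg (does (accepts? js ≟ᵇ v))))
      where
      zero-sum : ∀ t → sumVec {n} t (λ _ → 0#) ≈ 0#
      zero-sum zero    = refl
      zero-sum (suc t) = sum-zero {n} λ j → zero-sum t

    𝔼-sumVec : ∀ m s (g : Vec (Fin n) s → List (Fin n) → Carrier) →
               𝔼 m (λ f → sumVec s λ js → g js f) ≈ sumVec s λ js → 𝔼 m (g js)
    𝔼-sumVec m zero    g = refl
    𝔼-sumVec m (suc s) g = trans (𝔼-sum m {n} _) (sum-cong λ j → 𝔼-sumVec m s (g ∘ (j ∷_)))

    uniform-sum : ∀ i → sum (uniformOracle (A i)) ≈ 1#
    uniform-sum i = sum-uniformOracle (A i) (A≠∅ i)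

    count-select : ∀ {k} (b : Fin k → Bool) (js : Fin k → Fin n) p →
      fromℕ (count p (select b js)) ≈ sum (λ i → if b i then indicator (p (js i)) else 0#)
    count-select {zero}  b js p = refl
    count-select {suc k} b js p with b zero
    ... | true  = trans (count-∷ p (js zero) (select (b ∘ suc) (js ∘ suc))) (+-congˡ (count-select (b ∘ suc) (js ∘ suc) p))
    ... | false = trans (count-select (b ∘ suc) (js ∘ suc) p) (sym (+-identityˡ _))

    slack : Carrier
    slack = T * (T * (T * recip Q + T * recip Q))

    slack-nonneg : 0# ≤ slack
    slack-nonneg = *-nonneg 0≤T (*-nonneg 0≤T (+-nonneg 0≤Tr 0≤Tr))
      where
      0≤T = fromℕ-nonneg (suc t)
      0≤Tr = *-nonneg 0≤T (recip-nonneg Q)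

    module Scale (M : ℕ) .{{_ : ℕ.NonZero M}} (b : Fin t → Bool) (scaled : ∀ i → Scaled M Q (b i) (A i)) where
      open Comparison n t M Q using (error)
      open Comparison.Queries n t M Q A A≠∅ b scaled using (totalError; uniformOracle≤𝔼-empiricalOracle)

      P : Vec (Fin n) t → Carrier
      P = independent (uniformOracle ∘ A)

      P-nonneg : ∀ js → 0# ≤ P js
      P-nonneg js = product-nonneg λ i → uniformOracle-nonneg (A i) (lookup js i)

      collision : ∀ k B → Scaled M Q true (A k) → Scaled M Q false B →
                  sum (λ x → uniformOracle (A k) x * indicator (lookup B x)) ≤ recip Q
      collision k B big small = begin
        sum (λ x → uniformOracle (A k) x * indicator (lookup B x))
          ≤⟨ sum-mono (λ x → *-monoˡ-≤ (indicator-nonneg (lookup B x)) (capped x)) ⟩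
        sum (λ x → recip ∣ A k ∣ * indicator (lookup B x))
          ≈⟨ Sum.*-distribˡ-sum (recip ∣ A k ∣) (λ x → indicator (lookup B x)) ⟨
        recip ∣ A k ∣ * sum (λ x → indicator (lookup B x))
          ≈⟨ trans (*-congˡ (sum-indicator-lookup B)) (*-comm _ _) ⟩
        fromℕ ∣ B ∣ * recip ∣ A k ∣
          ≤⟨ cross-multiply (∣ B ∣) Q (∣ A k ∣) 1 (≡.subst (∣ B ∣ ℕ.* Q ℕ.≤_) (≡.sym (ℕₚ.*-identityˡ _)) smaller) ⟩
        fromℕ 1 * recip Q
          ≈⟨ trans (*-congʳ fromℕ-1) (*-identityˡ _) ⟩
        recip Q ∎
        where
        instance _ = ∣A∣-nonZero (A≠∅ k)
        capped : ∀ x → uniformOracle (A k) x ≤ recip ∣ A k ∣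
        capped x with lookup (A k) x
        ... | true  = ≤-refl
        ... | false = recip-nonneg ∣ A k ∣
        smaller : ∣ B ∣ ℕ.* Q ℕ.≤ ∣ A k ∣
        smaller = ℕₚ.*-cancelˡ-≤ M (ℕₚ.≤-trans (ℕₚ.≤-reflexive (≡.sym (ℕₚ.*-assoc M ∣ B ∣ Q)))
          (ℕₚ.≤-trans small (ℕₚ.≤-trans (ℕₚ.m≤n*m n Q) big)))

      mean-error : ∀ i → sumVec t (λ js → P js * error (b i) (A i) (select b (lookup js)))
                         ≤ T * (T * recip Q + T * recip Q)
      mean-error i = lemma (b i) (scaled i)
        where
        0≤T = fromℕ-nonneg (suc t)
        0≤Tr = *-nonneg 0≤T (recip-nonneg Q)
        const-mean : ∀ x → sumVec t (λ js → P js * x) ≈ x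
        const-mean x = trans (sumVec-cong t λ js → *-comm (P js) x) (trans (sumVec-*ˡ t x P)
          (trans (*-congˡ (sumVec-independent t (uniformOracle ∘ A) uniform-sum)) (*-identityʳ x)))
        lemma : ∀ c → Scaled M Q c (A i) →
                sumVec t (λ js → P js * error c (A i) (select b (lookup js))) ≤ T * (T * recip Q + T * recip Q)
        lemma true _ = begin
          sumVec t (λ js → P js * (fromℕ (suc (t ℕ.+ t)) * recip Q))   ≈⟨ const-mean _ ⟩
          fromℕ (suc (t ℕ.+ t)) * recip Q
            ≤⟨ *-monoˡ-≤ (recip-nonneg Q) (fromℕ-mono-≤ (s≤s (ℕₚ.+-monoʳ-≤ t (ℕₚ.n≤1+n t)))) ⟩
          fromℕ (suc t ℕ.+ suc t) * recip Q         ≈⟨ trans (*-congʳ (fromℕ-+ (suc t) (suc t))) (distribʳ _ _ _) ⟩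
          T * recip Q + T * recip Q                 ≈⟨ *-identityˡ _ ⟨
          1# * (T * recip Q + T * recip Q)
            ≤⟨ *-monoˡ-≤ (+-nonneg 0≤Tr 0≤Tr) (x≤x+y (fromℕ-nonneg t)) ⟩
          T * (T * recip Q + T * recip Q)           ∎
        lemma false small = begin
          sumVec t (λ js → P js * (T * (hits js + T * recip Q)))
            ≈⟨ sumVec-cong t (λ js → solve 4 (λ p T h r → p :* (T :* (h :+ r)) := T :* (p :* h :+ p :* r)) refl (P js) T (hits js) (T * recip Q)) ⟩
          sumVec t (λ js → T * (P js * hits js + P js * (T * recip Q)))
            ≈⟨ trans (sumVec-*ˡ t T _) (*-congˡ (trans (sumVec-+ t _ _) (+-congˡ (const-mean _)))) ⟩
          T * (sumVec t (λ js → P js * hits js) + T * recip Q)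
            ≤⟨ *-monoʳ-≤ 0≤T (+-monoˡ-≤ _ mean-hits) ⟩
          T * (T * recip Q + T * recip Q) ∎
          where
          hits : Vec (Fin n) t → Carrier
          hits js = fromℕ (count (lookup (A i)) (select b (lookup js)))
          term : ∀ k → sumVec t (λ js → P js * (if b k then indicator (lookup (A i) (lookup js k)) else 0#)) ≤ recip Q
          term k with b k | scaled k
          ... | true  | big = ≤-trans (≤-reflexive (sumVec-marginal t (uniformOracle ∘ A) uniform-sum k
                                (λ x → indicator (lookup (A i) x)))) (collision k (A i) big small)
          ... | false | _   = ≤-trans (≤-reflexive (const-mean 0#)) (recip-nonneg Q)
          mean-hits : sumVec t (λ js → P js * hits js) ≤ T * recip Q
          mean-hits = begin
            sumVec t (λ js → P js * hits js)
              ≈⟨ sumVec-cong t (λ js → trans (*-congˡ (count-select b (lookup js) (lookup (A i)))) (Sum.*-distribˡ-sum {t} (P js) _)) ⟩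
            sumVec t (λ js → sum (λ k → P js * (if b k then indicator (lookup (A i) (lookup js k)) else 0#)))
              ≈⟨ sumVec-sum t {t} _ ⟩
            sum (λ k → sumVec t (λ js → P js * (if b k then indicator (lookup (A i) (lookup js k)) else 0#)))
              ≤⟨ sum-mono term ⟩
            sum {t} (λ _ → recip Q)   ≈⟨ sum-const t (recip Q) ⟩
            fromℕ t * recip Q         ≤⟨ *-monoˡ-≤ (recip-nonneg Q) (fromℕ-mono-≤ (ℕₚ.n≤1+n t)) ⟩
            T * recip Q               ∎

      mean-totalError : sumVec t (λ js → P js * totalError (lookup js)) ≤ slack
      mean-totalError = begin
        sumVec t (λ js → P js * totalError (lookup js))
          ≈⟨ trans (sumVec-cong t (λ js → Sum.*-distribˡ-sum {t} (P js) _)) (sumVec-sum t {t} _) ⟩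
        sum (λ i → sumVec t (λ js → P js * error (b i) (A i) (select b (lookup js))))
          ≤⟨ sum-mono mean-error ⟩
        sum {t} (λ _ → δ)   ≈⟨ sum-const t δ ⟩
        fromℕ t * δ         ≤⟨ *-monoˡ-≤ 0≤δ (fromℕ-mono-≤ (ℕₚ.n≤1+n t)) ⟩
        T * δ               ∎
        where
        δ = T * (T * recip Q + T * recip Q)
        0≤δ : 0# ≤ δ
        0≤δ = *-nonneg (fromℕ-nonneg (suc t)) (+-nonneg 0≤Tr 0≤Tr)
          where 0≤Tr = *-nonneg (fromℕ-nonneg (suc t)) (recip-nonneg Q)

      run-uniform≤𝔼-run : run uniformOracle true ≤ 𝔼 (t ℕ.+ M) (λ f → run (empiricalOracle f) true) + slack
      run-uniform≤𝔼-run = begin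
        sumVec t (λ js → P js * acc js)
          ≤⟨ sumVec-mono t pointwise ⟩
        sumVec t (λ js → 𝔼 (t ℕ.+ M) (λ f → E f js * acc js) + P js * totalError (lookup js))
          ≈⟨ trans (sumVec-+ t _ _) (+-congʳ (sym (𝔼-sumVec (t ℕ.+ M) t _))) ⟩
        𝔼 (t ℕ.+ M) (λ f → run (empiricalOracle f) true) + sumVec t (λ js → P js * totalError (lookup js))
          ≤⟨ +-monoʳ-≤ _ mean-totalError ⟩
        𝔼 (t ℕ.+ M) (λ f → run (empiricalOracle f) true) + slack ∎
        where
        acc : Vec (Fin n) t → Carrier
        acc js = indicator (does (accepts? js ≟ᵇ true))
        E : List (Fin n) → Vec (Fin n) t → Carrier
        E f = independent (empiricalOracle f ∘ A)
        pointwise : ∀ js → P js * acc js ≤ 𝔼 (t ℕ.+ M) (λ f → E f js * acc js) + P js * totalError (lookup js)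
        pointwise js = begin
          P js * acc js
            ≤⟨ *-monoˡ-≤ 0≤acc (uniformOracle≤𝔼-empiricalOracle (lookup js)) ⟩
          (𝔼 (t ℕ.+ M) (λ f → E f js) + P js * R) * acc js
            ≈⟨ solve 3 (λ e q c → (e :+ q) :* c := c :* e :+ q :* c) refl (𝔼 (t ℕ.+ M) (λ f → E f js)) (P js * R) (acc js) ⟩
          acc js * 𝔼 (t ℕ.+ M) (λ f → E f js) + P js * R * acc js
            ≤⟨ +-mono-≤ (≤-reflexive (trans (sym (𝔼-*ˡ (t ℕ.+ M) (acc js) _)) (𝔼-cong (t ℕ.+ M) λ f → *-comm _ _)))
                 (≤-trans (*-monoʳ-≤ 0≤PR (indicator≤1 (does (accepts? js ≟ᵇ true)))) (≤-reflexive (*-identityʳ _))) ⟩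
          𝔼 (t ℕ.+ M) (λ f → E f js * acc js) + P js * R ∎
          where
          R = totalError (lookup js)
          0≤acc : 0# ≤ acc js
          0≤acc = indicator-nonneg (does (accepts? js ≟ᵇ true))
          0≤PR : 0# ≤ P js * R
          0≤PR = *-nonneg (P-nonneg js) (sum-nonneg λ i → Comparison.error-nonneg n t M Q (b i) (A i) (select b (lookup js)))

  -- Averaging over the scales

  <-≤-trans : ∀ {x y z} → x < y → y ≤ z → x < z
  <-≤-trans {z = z} x<y y≤z with <-cotrans x<y z
  ... | inj₁ x<z = x<z
  ... | inj₂ z<y = contradiction z<y y≤z

  fromℕ-mono-< : ∀ {m n} → m ℕ.< n → fromℕ m < fromℕ n
  fromℕ-mono-< {m} m<n = <-≤-trans
    (<-respˡ-≈ (+-identityˡ _) (+-monoˡ (fromℕ m) 0<1)) (fromℕ-mono-≤ m<n)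

  fromℕ-cancel-≤ : ∀ {m n} → fromℕ m ≤ fromℕ n → m ℕ.≤ n
  fromℕ-cancel-≤ m≤n = ℕₚ.≮⇒≥ λ n<m → m≤n (fromℕ-mono-< n<m)

  module AllScales (n : ℕ) .{{_ : ℕ.NonZero n}} (t : ℕ) (A : Fin t → Subset n) (A≠∅ : ∀ i → Nonempty (A i))
                   (accepts? : Vec (Fin n) t → Bool) (Q : ℕ) .{{_ : ℕ.NonZero Q}} where
    open Expectation n
    open Oracles n
    open Seed n t A A≠∅ accepts? Q

    intermediate : ℕ → Fin t → Bool
    intermediate M i = not (does (Q ℕ.* n ℕ.≤? M ℕ.* ∣ A i ∣)) ∧ not (does (M ℕ.* ∣ A i ∣ ℕ.* Q ℕ.≤? n))

    intermediate⇒ : ∀ M i → intermediate M i ≡ true →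
                    M ℕ.* ∣ A i ∣ ℕ.< Q ℕ.* n × n ℕ.< M ℕ.* ∣ A i ∣ ℕ.* Q
    intermediate⇒ M i eq with neither (Q ℕ.* n ℕ.≤? M ℕ.* ∣ A i ∣) (M ℕ.* ∣ A i ∣ ℕ.* Q ℕ.≤? n) eq
      where
      neither : ∀ {P R : Set} (p? : Dec P) (r? : Dec R) → not (does p?) ∧ not (does r?) ≡ true → ¬ P × ¬ R
      neither (no ¬p) (no ¬r) _ = ¬p , ¬r
    ... | ¬big , ¬small = ℕₚ.≰⇒> ¬big , ℕₚ.≰⇒> ¬small

    ¬intermediate⇒ : ∀ M i → intermediate M i ≢ true → Scaled M Q (does (Q ℕ.* n ℕ.≤? M ℕ.* ∣ A i ∣)) (A i)
    ¬intermediate⇒ M i = either (Q ℕ.* n ℕ.≤? M ℕ.* ∣ A i ∣) (M ℕ.* ∣ A i ∣ ℕ.* Q ℕ.≤? n)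
      where
      either : (p? : Dec (Scaled M Q true (A i))) (r? : Dec (Scaled M Q false (A i))) →
               not (does p?) ∧ not (does r?) ≢ true → Scaled M Q (does p?) (A i)
      either (yes p) _       _   = p
      either (no _)  (yes r) _   = r
      either (no _)  (no _)  neq = contradiction ≡.refl neq

    gap : ℕ → Carrier
    gap M = sum λ i → indicator (intermediate M i)

    run-scale : ∀ M .{{_ : ℕ.NonZero M}} →
      run uniformOracle true ≤ 𝔼 (t ℕ.+ M) (λ f → run (empiricalOracle f) true) + (slack + gap M)
    run-scale M with any? (λ i → intermediate M i ≟ᵇ true)
    ... | yes (i , eq) = begin
      run uniformOracle true            ≤⟨ x≤x+y (run-nonneg uniformOracle false λ i → uniformOracle-nonneg (A i)) ⟩
      run uniformOracle true + run uniformOracle false  ≈⟨ run-total uniformOracle uniform-sum ⟩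
      1#                                ≈⟨ reflexive (≡.cong indicator eq) ⟨
      indicator (intermediate M i)      ≤⟨ term≤sum (λ i → indicator-nonneg (intermediate M i)) i ⟩
      gap M                             ≤⟨ x≤x+y slack-nonneg ⟩
      gap M + slack                     ≈⟨ +-comm _ _ ⟩
      slack + gap M                     ≤⟨ x≤x+y 0≤𝔼 ⟩
      slack + gap M + 𝔼 (t ℕ.+ M) (λ f → run (empiricalOracle f) true)  ≈⟨ +-comm _ _ ⟩
      𝔼 (t ℕ.+ M) (λ f → run (empiricalOracle f) true) + (slack + gap M) ∎
      where
      0≤𝔼 : 0# ≤ 𝔼 (t ℕ.+ M) (λ f → run (empiricalOracle f) true)
      0≤𝔼 = 𝔼-nonneg (t ℕ.+ M) λ f → run-nonneg (empiricalOracle f) true λ i → empiricalOracle-nonneg f (A i)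
    ... | no none = ≤-trans (Scale.run-uniform≤𝔼-run M _ λ i → ¬intermediate⇒ M i λ eq → none (i , eq))
      (+-monoʳ-≤ _ (x≤x+y (sum-nonneg λ i → indicator-nonneg (intermediate M i))))

    scale : ℕ → ℕ
    scale k = (Q ℕ.* Q) ℕ.^ k

    intermediate-unique : ∀ {K} i (k l : Fin K) → k Fin.< l →
      intermediate (scale (toℕ k)) i ≡ true → ¬ intermediate (scale (toℕ l)) i ≡ true
    intermediate-unique i k l k<l eqₖ eqₗ with intermediate⇒ (scale (toℕ k)) i eqₖ | intermediate⇒ (scale (toℕ l)) i eqₗ
    ... | _ , n<MaQ | M′a<Qn , _ = ℕₚ.<-irrefl ≡.refl (ℕₚ.<-≤-trans
      (ℕₚ.<-trans M′a<Qn (ℕₚ.*-monoʳ-< Q n<MaQ)) (ℕₚ.≤-trans (ℕₚ.≤-reflexive rearrange)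
        (ℕₚ.*-monoˡ-≤ ∣ A i ∣ (ℕₚ.^-monoʳ-≤ (Q ℕ.* Q) {{ℕₚ.m*n≢0 Q Q}} k<l))))
      where
      rearrange : Q ℕ.* (scale (toℕ k) ℕ.* ∣ A i ∣ ℕ.* Q) ≡ Q ℕ.* Q ℕ.* scale (toℕ k) ℕ.* ∣ A i ∣
      rearrange = +-*-Solver.solve 3 (λ Q s a → Q +-*-Solver.:* (s +-*-Solver.:* a +-*-Solver.:* Q)
        +-*-Solver.:= Q +-*-Solver.:* Q +-*-Solver.:* s +-*-Solver.:* a) ≡.refl Q (scale (toℕ k)) (∣ A i ∣)

    run-all-scales : ∀ K → fromℕ K * run uniformOracle true ≤
      sum {K} (λ k → 𝔼 (t ℕ.+ scale (toℕ k)) (λ f → run (empiricalOracle f) true)) + (fromℕ K * slack + fromℕ t)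
    run-all-scales K = begin
      fromℕ K * run uniformOracle true        ≈⟨ sum-const K _ ⟨
      sum {K} (λ _ → run uniformOracle true)  ≤⟨ sum-mono (λ k → run-scale (scale (toℕ k)) {{scale-nonZero k}}) ⟩
      sum {K} (λ k → e k + (slack + gap (scale (toℕ k))))
        ≈⟨ trans (Sum.∑-distrib-+ {K} _ _) (+-congˡ (trans (Sum.∑-distrib-+ {K} _ _) (+-congʳ (sum-const K slack)))) ⟩
      sum e + (fromℕ K * slack + sum {K} (λ k → gap (scale (toℕ k))))
        ≤⟨ +-monoʳ-≤ _ (+-monoʳ-≤ _ gaps) ⟩
      sum e + (fromℕ K * slack + fromℕ t)     ∎
      where
      scale-nonZero : ∀ (k : Fin K) → ℕ.NonZero (scale (toℕ k))
      scale-nonZero k = ℕₚ.m^n≢0 (Q ℕ.* Q) (toℕ k) {{ℕₚ.m*n≢0 Q Q}}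
      e : Fin K → Carrier
      e k = 𝔼 (t ℕ.+ scale (toℕ k)) (λ f → run (empiricalOracle f) true)
      gaps : sum {K} (λ k → gap (scale (toℕ k))) ≤ fromℕ t
      gaps = begin
        sum {K} (λ k → sum {t} (λ i → indicator (intermediate (scale (toℕ k)) i)))
          ≈⟨ Sum.∑-comm {K} {t} _ ⟩
        sum {t} (λ i → sum {K} (λ k → indicator (intermediate (scale (toℕ k)) i)))
          ≤⟨ sum-mono (λ i → sum-indicator-unique {K} (λ k → intermediate (scale (toℕ k)) i) (intermediate-unique i)) ⟩
        sum {t} (λ _ → 1#)  ≈⟨ trans (sum-const t 1#) (*-identityʳ _) ⟩
        fromℕ t             ∎

  module WholeTester (n : ℕ) .{{_ : ℕ.NonZero n}} (t : ℕ) (T : Tester n t) (Q : ℕ) .{{_ : ℕ.NonZero Q}} where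
    open Expectation n
    open Oracles n
    open Tester T

    module At (r : Fin seeds) where
      open Seed n t (lookup (queries r)) (nonempty r) (accepts? r) Q public
      open AllScales n t (lookup (queries r)) (nonempty r) (accepts? r) Q public using (run-all-scales)

    η : Carrier
    η = fromℕ (suc t) * (fromℕ (suc t) * (fromℕ (suc t) * recip Q + fromℕ (suc t) * recip Q))

    scale : ℕ → ℕ
    scale k = (Q ℕ.* Q) ℕ.^ k

    Σweight : sum weight ≈ 1#
    Σweight = proj₂ weight-isD

    verdict-total : ∀ q → (∀ A → Nonempty A → sum (q A) ≈ 1#) → verdictProb T q true + verdictProb T q false ≈ 1#
    verdict-total q eq = begin-equality
      verdictProb T q true + verdictProb T q false
        ≈⟨ Sum.∑-distrib-+ {seeds} _ _ ⟨
      sum (λ r → weight r * At.run r q true + weight r * At.run r q false)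
        ≈⟨ sum-cong (λ r → trans (sym (distribˡ _ _ _)) (trans (*-congˡ
             (At.run-total r q λ i → eq (lookup (queries r) i) (nonempty r i))) (*-identityʳ _))) ⟩
      sum weight  ≈⟨ Σweight ⟩
      1#          ∎

    verdict-all-scales : ∀ K → fromℕ K * verdictProb T uniformOracle true ≤
      sum {K} (λ k → 𝔼 (t ℕ.+ scale (toℕ k)) (λ f → verdictProb T (empiricalOracle f) true)) + (fromℕ K * η + fromℕ t)
    verdict-all-scales K = begin
      fromℕ K * sum (λ r → weight r * U r)
        ≈⟨ trans (Sum.*-distribˡ-sum {seeds} (fromℕ K) _) (sum-cong λ r →
             solve 3 (λ k w u → k :* (w :* u) := w :* (k :* u)) refl (fromℕ K) (weight r) (U r)) ⟩
      sum (λ r → weight r * (fromℕ K * U r))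
        ≤⟨ sum-mono (λ r → *-monoʳ-≤ (proj₁ weight-isD r) (At.run-all-scales r K)) ⟩
      sum (λ r → weight r * (sum (e r) + R))
        ≈⟨ trans (sum-cong {seeds} λ r → distribˡ (weight r) (sum (e r)) R) (Sum.∑-distrib-+ {seeds} _ _) ⟩
      sum (λ r → weight r * sum (e r)) + sum (λ r → weight r * R)
        ≈⟨ +-cong exchange (trans (sym (Sum.*-distribʳ-sum R weight)) (trans (*-congʳ Σweight) (*-identityˡ R))) ⟩
      sum {K} (λ k → 𝔼 (t ℕ.+ scale (toℕ k)) (λ f → verdictProb T (empiricalOracle f) true)) + R ∎
      where
      U : Fin seeds → Carrier
      U r = At.run r uniformOracle true
      R = fromℕ K * η + fromℕ t
      m : Fin K → ℕ
      m k = t ℕ.+ scale (toℕ k)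
      e : Fin seeds → Fin K → Carrier
      e r k = 𝔼 (m k) (λ f → At.run r (empiricalOracle f) true)
      exchange : sum (λ r → weight r * sum (e r)) ≈ sum (λ k → 𝔼 (m k) (λ f → verdictProb T (empiricalOracle f) true))
      exchange = begin-equality
        sum (λ r → weight r * sum (e r))
          ≈⟨ sum-cong (λ r → Sum.*-distribˡ-sum (weight r) (e r)) ⟩
        sum (λ r → sum (λ k → weight r * e r k))
          ≈⟨ Sum.∑-comm {seeds} {K} _ ⟩
        sum (λ k → sum (λ r → weight r * e r k))
          ≈⟨ sum-cong {K} (λ k → trans (sum-cong λ r → sym (𝔼-*ˡ (m k) (weight r) _)) (sym (𝔼-sum (m k) {seeds} (λ r f → weight r * At.run r (empiricalOracle f) true)))) ⟩
        sum {K} (λ k → 𝔼 (m k) (λ f → verdictProb T (empiricalOracle f) true)) ∎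

    module _ (tests : IsUniformityTester (recip 2 * recip 2) (recip 3) T) where
      open IsUniformityTester tests

      accepts-uniform : 1# - recip 3 ≤ verdictProb T uniformOracle true
      accepts-uniform = accepts (uniform n) uniformOracle uniform-isDistribution uniformOracle-isConditional λ _ → refl

      accepts-empirical : ∀ f .{{_ : ℕ.NonZero (length f)}} → length f ℕ.* 2 ℕ.≤ n →
                          verdictProb T (empiricalOracle f) true ≤ recip 3
      accepts-empirical f far = +-cancelʳ-≤ (1# - recip 3) (begin
        verdictProb T (empiricalOracle f) true + (1# - recip 3)
          ≤⟨ +-monoʳ-≤ _ (rejects (empirical f) (empiricalOracle f) (empirical-isDistribution f)
               (empiricalOracle-isConditional f) (empirical-far f far)) ⟩
        verdictProb T (empiricalOracle f) true + verdictProb T (empiricalOracle f) false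
          ≈⟨ verdict-total (empiricalOracle f) (sum-empiricalOracle f) ⟩
        1#                          ≈⟨ difference (recip 3) 1# ⟨
        recip 3 + (1# - recip 3)    ∎)

      averaged : ∀ K .{{_ : ℕ.NonZero K}} → (∀ (k : Fin K) → (t ℕ.+ scale (toℕ k)) ℕ.* 2 ℕ.≤ n) →
                 fromℕ K * (1# - recip 3) ≤ fromℕ K * recip 3 + (fromℕ K * η + fromℕ t)
      averaged K fits = begin
        fromℕ K * (1# - recip 3)                          ≤⟨ *-monoʳ-≤ (fromℕ-nonneg K) accepts-uniform ⟩
        fromℕ K * verdictProb T uniformOracle true        ≤⟨ verdict-all-scales K ⟩
        sum {K} (λ k → 𝔼 (t ℕ.+ scale (toℕ k)) (λ f → verdictProb T (empiricalOracle f) true)) + (fromℕ K * η + fromℕ t)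
          ≤⟨ +-monoˡ-≤ _ (sum-mono {K} λ k → ≤-trans (𝔼-mono (t ℕ.+ scale (toℕ k)) λ f eq →
               accepts-empirical f {{≡.subst ℕ.NonZero (≡.sym eq) (m-nonZero k)}} (≡.subst (λ l → l ℕ.* 2 ℕ.≤ n) (≡.sym eq) (fits k)))
               (≤-reflexive (𝔼-const (t ℕ.+ scale (toℕ k)) (recip 3)))) ⟩
        sum {K} (λ _ → recip 3) + (fromℕ K * η + fromℕ t)  ≈⟨ +-congʳ (sum-const K (recip 3)) ⟩
        fromℕ K * recip 3 + (fromℕ K * η + fromℕ t)        ∎
        where
        m-nonZero : ∀ (k : Fin K) → ℕ.NonZero (t ℕ.+ scale (toℕ k))
        m-nonZero k = ℕ.>-nonZero (ℕₚ.≤-trans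
          (ℕ.>-nonZero⁻¹ (scale (toℕ k)) {{ℕₚ.m^n≢0 (Q ℕ.* Q) (toℕ k) {{ℕₚ.m*n≢0 Q Q}}}}) (ℕₚ.m≤n+m _ t))

  no-tester : ∀ n .{{_ : ℕ.NonZero n}} t (T : Tester n t) → 2 ℕ.^ (2 ℕ.^ (10 ℕ.* suc t)) ℕ.≤ n →
              ¬ IsUniformityTester (recip 2 * recip 2) (recip 3) T
  no-tester n t tester large tests = ℕₚ.<⇒≱ (ℕₚ.m≤m+n 11 1) (fromℕ-cancel-≤ (begin
    fromℕ 12                         ≈⟨ cancel (fromℕ 12) ⟨
    fromℕ 12 * r * fromℕ 12          ≤⟨ *-monoˡ-≤ (fromℕ-nonneg 12) 12r≤10r ⟩
    fromℕ 10 * r * fromℕ 12          ≈⟨ cancel (fromℕ 10) ⟩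
    fromℕ 10                         ∎))
    where
    T = suc t
    Q = threshold T
    K = scaleCount T
    instance
      T²≢0 : ℕ.NonZero (T ℕ.* T)
      T²≢0 = ℕₚ.m*n≢0 T T
      T³≢0 : ℕ.NonZero (T ℕ.* (T ℕ.* T))
      T³≢0 = ℕₚ.m*n≢0 T (T ℕ.* T)
      Q≢0 : ℕ.NonZero Q
      Q≢0 = ℕₚ.m*n≢0 24 (T ℕ.* (T ℕ.* T))
      K≢0 : ℕ.NonZero K
      K≢0 = ℕₚ.m*n≢0 12 T
    open WholeTester n t tester Q
    r = recip 12
    cancel : ∀ x → x * r * fromℕ 12 ≈ x
    cancel x = trans (*-assoc _ _ _) (trans (*-congˡ (recip-inverseˡ 12)) (*-identityʳ x))
    third : recip 3 ≤ fromℕ 4 * r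
    third = ≤-trans (≤-reflexive (sym (trans (*-congʳ fromℕ-1) (*-identityˡ _)))) (cross-multiply 1 12 3 4 ℕₚ.≤-refl)
    η≤r : η ≤ r
    η≤r = begin
      fromℕ T * (fromℕ T * (fromℕ T * recip Q + fromℕ T * recip Q))
        ≈⟨ solve 2 (λ T q → T :* (T :* (T :* q :+ T :* q)) := T :* (T :* (T :+ T)) :* q) refl (fromℕ T) (recip Q) ⟩
      fromℕ T * (fromℕ T * (fromℕ T + fromℕ T)) * recip Q
        ≈⟨ *-congʳ (trans (fromℕ-* T (T ℕ.* (T ℕ.+ T))) (*-congˡ (trans (fromℕ-* T (T ℕ.+ T)) (*-congˡ (fromℕ-+ T T))))) ⟨
      fromℕ (T ℕ.* (T ℕ.* (T ℕ.+ T))) * recip Q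
        ≤⟨ cross-multiply (T ℕ.* (T ℕ.* (T ℕ.+ T))) 12 Q 1 (ℕₚ.≤-reflexive
             (+-*-Solver.solve 1 (λ T → T ⊗ (T ⊗ (T ⊕ T)) ⊗ conℕ 12 ⊜ conℕ 1 ⊗ (conℕ 24 ⊗ (T ⊗ (T ⊗ T)))) ≡.refl T)) ⟩
      fromℕ 1 * r
        ≈⟨ trans (*-congʳ fromℕ-1) (*-identityˡ r) ⟩
      r ∎
      where open +-*-Solver using () renaming (_:*_ to _⊗_; _:+_ to _⊕_; con to conℕ; _:=_ to _⊜_)
    t≤Kr : fromℕ t ≤ fromℕ K * r
    t≤Kr = begin
      fromℕ t                      ≤⟨ fromℕ-mono-≤ (ℕₚ.n≤1+n t) ⟩
      fromℕ T                      ≈⟨ cancel (fromℕ T) ⟨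
      fromℕ T * r * fromℕ 12       ≈⟨ solve 3 (λ t r k → t :* r :* k := k :* t :* r) refl (fromℕ T) r (fromℕ 12) ⟩
      fromℕ 12 * fromℕ T * r       ≈⟨ *-congʳ (fromℕ-* 12 T) ⟨
      fromℕ K * r                  ∎
    main : (1# - recip 3) * fromℕ K ≤ (recip 3 + (r + r)) * fromℕ K
    main = begin
      (1# - recip 3) * fromℕ K     ≈⟨ *-comm _ _ ⟩
      fromℕ K * (1# - recip 3)     ≤⟨ averaged tests K (scales-fit t large) ⟩
      fromℕ K * recip 3 + (fromℕ K * η + fromℕ t)
        ≤⟨ +-monoʳ-≤ _ (+-mono-≤ (*-monoʳ-≤ (fromℕ-nonneg K) η≤r) t≤Kr) ⟩
      fromℕ K * recip 3 + (fromℕ K * r + fromℕ K * r)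
        ≈⟨ solve 3 (λ k u r → k :* u :+ (k :* r :+ k :* r) := (u :+ (r :+ r)) :* k) refl (fromℕ K) (recip 3) r ⟩
      (recip 3 + (r + r)) * fromℕ K ∎
    12r≤10r : fromℕ 12 * r ≤ fromℕ 10 * r
    12r≤10r = begin
      fromℕ 12 * r                     ≈⟨ recip-inverseʳ 12 ⟩
      1#                               ≈⟨ trans (+-comm _ _) (difference (recip 3) 1#) ⟨
      (1# - recip 3) + recip 3         ≤⟨ +-monoˡ-≤ (recip 3) (*-cancelʳ-≤ (fromℕ-positive K) main) ⟩
      recip 3 + (r + r) + recip 3      ≤⟨ +-mono-≤ (+-monoˡ-≤ (r + r) third) third ⟩
      fromℕ 4 * r + (r + r) + fromℕ 4 * r
        ≈⟨ solve 2 (λ f r → f :* r :+ (r :+ r) :+ f :* r := (f :+ (f :+ (con 1 :+ (con 1 :+ con 0)))) :* r) refl (fromℕ 4) r ⟩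
      (fromℕ 4 + (fromℕ 4 + fromℕ 2)) * r
        ≈⟨ *-congʳ (trans (fromℕ-+ 4 6) (+-congˡ (fromℕ-+ 4 2))) ⟨
      fromℕ 10 * r                     ∎

  samples-bound : ∀ n → 2 ℕ.^ (2 ℕ.^ 10) ℕ.≤ n → ∀ t (T : Tester n t) →
                  IsUniformityTester (recip 2 * recip 2) (recip 3) T → recip 20 * fromℕ (loglog n) ≤ fromℕ t
  samples-bound n N≤n t T tests t<cL = no-tester n {{n≢0}} t T (loglog-large t N≤n t*20<L) tests
    where
    n≢0 : ℕ.NonZero n
    n≢0 = ℕ.>-nonZero (ℕₚ.<-≤-trans (ℕₚ.m^n>0 2 (2 ℕ.^ 10)) N≤n)
    t*20<L : t ℕ.* 20 ℕ.< loglog n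
    t*20<L = ℕₚ.≰⇒> λ L≤ → ≤-trans (*-monoʳ-≤ (recip-nonneg 20) (fromℕ-mono-≤ L≤)) (≤-reflexive (begin-equality
      recip 20 * fromℕ (t ℕ.* 20)        ≈⟨ *-congˡ (fromℕ-* t 20) ⟩
      recip 20 * (fromℕ t * fromℕ 20)    ≈⟨ solve 3 (λ r t f → r :* (t :* f) := t :* (r :* f)) refl (recip 20) (fromℕ t) (fromℕ 20) ⟩
      fromℕ t * (recip 20 * fromℕ 20)    ≈⟨ trans (*-congˡ (recip-inverseˡ 20)) (*-identityʳ _) ⟩
      fromℕ t                            ∎)) t<cL

theorem7p2p1 : ∀ {a ℓ₁ ℓ₂} (ℝ : RealField a ℓ₁ ℓ₂) →
    let open RealField ℝ
        open Testing ℝ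
    in
    ∃[ ε ] ∃[ c ] (0# < ε) × (0# < c) ×
      (∃[ N ] ∀ (n : ℕ) → N ℕ.≤ n →
        ∀ (t : ℕ) (T : Tester n t) → IsUniformityTester ε (recip 3) T →
        c * fromℕ (loglog n) ≤ fromℕ t)
theorem7p2p1 ℝ = recip 2 * recip 2 , recip 20 ,
  *-pos (recip-positive ℝ 2) (recip-positive ℝ 2) , recip-positive ℝ 20 ,
  2 ℕ.^ (2 ℕ.^ 10) , samples-bound ℝ
  where open RealField ℝ
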